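{- Let $d$, $n$, $r$ be positive integers with $\gcd(d,n)=1$ and $n$ odd. Let $s$ be an integer with $0\leqslant s\leqslant n-1$ and $s\equiv \langle -r/d\rangle_n+1\pmod 2$. Then $$ \sum_{k=s}^{n-1}\frac{(aq^r;q^d)_k\,(bq^{d-r};q^d)_k\,(q^d;q^{2d})_k\, q^{dk}}{(q^d;q^d)_{k-s}\,(q^d;q^d)_{k+s}\,(abq^{2d};q^{2d})_k} \equiv 0 \pmod{(1-aq^{r+d\langle -r/d\rangle_n})(1-bq^{d-r+d\langle (r-d)/d\rangle_n})}. $$
   Context: $a,b,q$ are indeterminates. The $q$-shifted factorial is $(x;q)_0=1$ and $(x;q)_m=(1-x)(1-xq)\cdots(1-xq^{m-1})$ for $m\geqslant1$. For a rational number $x$ and a positive integer $m$ such that the denominator of $x$ is coprime to $m$, $\langle x\rangle_m$ denotes the least non-negative residue of $x$ modulo $m$. For rational functions $A,B$ and a polynomial $P$ (in the indeterminates involved), $A\equiv B\pmod P$ means that $A-B=P\cdot C/D$ for polynomials $C,D$ with $D$ coprime to $P$. -}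

module Defs where

open import Level using (Level; _⊔_; 0ℓ) renaming (suc to lsuc)
open import Algebra.Bundles using (CommutativeRing; CommutativeSemigroup; Semiring)
open import Algebra.Structures using (IsAbelianGroup)
import Algebra.Properties.CommutativeSemigroup as CommutativeSemigroupProperties
import Algebra.Properties.Group as GroupProperties
import Algebra.Properties.Ring as RingProperties
import Algebra.Definitions.RawSemiring as RawSemiringDefinitions
import Algebra.Solver.Ring.NaturalCoefficients.Default as SemiringSolver
open import Data.Fin.Base using (toℕ)
open import Data.Integer.Base as ℤ using (ℤ; +_; -[1+_])
open import Data.List.Base using (List; []; _∷_; map; upTo; filter; head)
open import Data.Maybe.Base using (fromMaybe)
open import Data.Nat.Base as ℕ using (ℕ; zero; suc; _∸_)
open import Data.Nat.Divisibility using (_∣?_)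
open import Data.Product.Base using (Σ; ∃-syntax; _×_; _,_)
open import Data.Rational.Base as ℚ using (ℚ; ↥_)
import Data.Rational.Properties as ℚₚ
open import Data.Sum.Base using (_⊎_; inj₁; inj₂; [_,_]′; map₁)
open import Function.Base using (_∘_; id)
open import Relation.Binary.Definitions using (Decidable)
open import Relation.Binary.PropositionalEquality.Core as ≡ using (_≡_)
open import Relation.Binary.PropositionalEquality.Properties using (module ≡-Reasoning)
open import Relation.Binary.Structures using (IsEquivalence)
open import Relation.Nullary.Decidable.Core using (yes; no)
open import Relation.Nullary.Negation.Core using (¬_; contradiction)
import Relation.Binary.Reasoning.Setoid as SetoidReasoning

record IntegralDomain (c ℓ : Level) : Set (lsuc (c ⊔ ℓ)) where
  field
    commutativeRing : CommutativeRing c ℓ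
  open CommutativeRing commutativeRing public
  field
    _≟_             : Decidable _≈_
    1≉0             : 1# ≉ 0#
    noZeroDivisors  : ∀ x y → x * y ≈ 0# → x ≈ 0# ⊎ y ≈ 0#

-- Univariate polynomials as coefficient lists, constant term first. Trailing
-- zeros are allowed, so equality is equality of all coefficients.
module Polynomial {c ℓ} (R : CommutativeRing c ℓ) where

  private
    module R = CommutativeRing R
    open R using (_≈_; _+_; _*_; -_; 0#; 1#)
    open RingProperties R.ring using (-0#≈0#)

  Poly : Set c
  Poly = List R.Carrier

  coeff : Poly → ℕ → R.Carrier
  coeff []      i       = 0#
  coeff (c ∷ p) zero    = c
  coeff (c ∷ p) (suc i) = coeff p i

  infix 4 _≈ₚ_
  record _≈ₚ_ (p p′ : Poly) : Set ℓ where
    constructor coeffs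
    field at : ∀ i → coeff p i ≈ coeff p′ i
  open _≈ₚ_ public

  infixl 6 _+ₚ_
  infixl 7 _*ₚ_ _·ₚ_
  infix  8 -ₚ_

  0ₚ 1ₚ X : Poly
  0ₚ = []
  1ₚ = 1# ∷ []
  X  = 0# ∷ 1# ∷ []

  const : R.Carrier → Poly
  const c = c ∷ []

  _+ₚ_ : Poly → Poly → Poly
  []      +ₚ q       = q
  (c ∷ p) +ₚ []      = c ∷ p
  (c ∷ p) +ₚ (e ∷ q) = c + e ∷ p +ₚ q

  -ₚ_ : Poly → Poly
  -ₚ_ = map (-_)

  _·ₚ_ : R.Carrier → Poly → Poly
  c ·ₚ p = map (c *_) p

  _*ₚ_ : Poly → Poly → Poly
  []      *ₚ q = []
  (c ∷ p) *ₚ q = c ·ₚ q +ₚ (0# ∷ p *ₚ q)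

  coeff-+ : ∀ p q i → coeff (p +ₚ q) i ≈ coeff p i + coeff q i
  coeff-+ []      q       i       = R.sym (R.+-identityˡ _)
  coeff-+ (c ∷ p) []      i       = R.sym (R.+-identityʳ _)
  coeff-+ (c ∷ p) (e ∷ q) zero    = R.refl
  coeff-+ (c ∷ p) (e ∷ q) (suc i) = coeff-+ p q i

  coeff-neg : ∀ p i → coeff (-ₚ p) i ≈ - coeff p i
  coeff-neg []      i       = R.sym -0#≈0#
  coeff-neg (c ∷ p) zero    = R.refl
  coeff-neg (c ∷ p) (suc i) = coeff-neg p i

  coeff-· : ∀ c p i → coeff (c ·ₚ p) i ≈ c * coeff p i
  coeff-· c []      i       = R.sym (R.zeroʳ c)
  coeff-· c (e ∷ p) zero    = R.refl
  coeff-· c (e ∷ p) (suc i) = coeff-· c p i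

  ≈ₚ-isEquivalence : IsEquivalence _≈ₚ_
  ≈ₚ-isEquivalence = record
    { refl  = coeffs λ _ → R.refl
    ; sym   = λ e → coeffs λ i → R.sym (at e i)
    ; trans = λ e f → coeffs λ i → R.trans (at e i) (at f i)
    }

  private
    open module ≈ₚ = IsEquivalence ≈ₚ-isEquivalence
      using () renaming (refl to reflₚ; sym to symₚ; trans to transₚ)

  ∷-cong : ∀ {c e p q} → c ≈ e → p ≈ₚ q → c ∷ p ≈ₚ e ∷ q
  at (∷-cong c≈e p≈q) zero    = c≈e
  at (∷-cong c≈e p≈q) (suc i) = at p≈q i

  tail-cong : ∀ {c e p q} → c ∷ p ≈ₚ e ∷ q → p ≈ₚ q
  at (tail-cong e) i = at e (suc i)

  tail-zero : ∀ {c p} → c ∷ p ≈ₚ [] → p ≈ₚ []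
  at (tail-zero e) i = at e (suc i)

  ∷-zero : ∀ {c p} → c ≈ 0# → p ≈ₚ [] → c ∷ p ≈ₚ []
  at (∷-zero c≈0 p≈0) zero    = c≈0
  at (∷-zero c≈0 p≈0) (suc i) = at p≈0 i

  +ₚ-cong : ∀ {p p′ q q′} → p ≈ₚ p′ → q ≈ₚ q′ → p +ₚ q ≈ₚ p′ +ₚ q′
  at (+ₚ-cong {p} {p′} {q} {q′} e f) i =
    R.trans (coeff-+ p q i)
      (R.trans (R.+-cong (at e i) (at f i)) (R.sym (coeff-+ p′ q′ i)))

  -ₚ-cong : ∀ {p q} → p ≈ₚ q → -ₚ p ≈ₚ -ₚ q
  at (-ₚ-cong {p} {q} e) i =
    R.trans (coeff-neg p i) (R.trans (R.-‿cong (at e i)) (R.sym (coeff-neg q i)))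

  ·ₚ-cong : ∀ {c e p q} → c ≈ e → p ≈ₚ q → c ·ₚ p ≈ₚ e ·ₚ q
  at (·ₚ-cong {c} {e} {p} {q} c≈e p≈q) i =
    R.trans (coeff-· c p i)
      (R.trans (R.*-cong c≈e (at p≈q i)) (R.sym (coeff-· e q i)))

  +ₚ-assoc : ∀ p q r → (p +ₚ q) +ₚ r ≈ₚ p +ₚ (q +ₚ r)
  at (+ₚ-assoc p q r) i =
    R.trans (coeff-+ (p +ₚ q) r i)
      (R.trans (R.+-congʳ (coeff-+ p q i))
        (R.trans (R.+-assoc _ _ _)
          (R.trans (R.+-congˡ (R.sym (coeff-+ q r i)))
            (R.sym (coeff-+ p (q +ₚ r) i)))))

  +ₚ-comm : ∀ p q → p +ₚ q ≈ₚ q +ₚ p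
  at (+ₚ-comm p q) i =
    R.trans (coeff-+ p q i)
      (R.trans (R.+-comm _ _) (R.sym (coeff-+ q p i)))

  +ₚ-identityʳ : ∀ p → p +ₚ [] ≈ₚ p
  at (+ₚ-identityʳ p) i = R.trans (coeff-+ p [] i) (R.+-identityʳ _)

  +ₚ-inverseˡ : ∀ p → -ₚ p +ₚ p ≈ₚ []
  at (+ₚ-inverseˡ p) i =
    R.trans (coeff-+ (-ₚ p) p i)
      (R.trans (R.+-congʳ (coeff-neg p i)) (R.-‿inverseˡ _))

  +ₚ-inverseʳ : ∀ p → p +ₚ -ₚ p ≈ₚ []
  +ₚ-inverseʳ p = transₚ (+ₚ-comm p (-ₚ p)) (+ₚ-inverseˡ p)

  +ₚ-isAbelianGroup : IsAbelianGroup _≈ₚ_ _+ₚ_ [] -ₚ_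
  +ₚ-isAbelianGroup = record
    { isGroup = record
      { isMonoid = record
        { isSemigroup = record
          { isMagma = record { isEquivalence = ≈ₚ-isEquivalence ; ∙-cong = +ₚ-cong }
          ; assoc = +ₚ-assoc
          }
        ; identity = (λ _ → reflₚ) , +ₚ-identityʳ
        }
      ; inverse = +ₚ-inverseˡ , +ₚ-inverseʳ
      ; ⁻¹-cong = -ₚ-cong
      }
    ; comm = +ₚ-comm
    }

  private
    +ₚ-commutativeSemigroup : CommutativeSemigroup c ℓ
    +ₚ-commutativeSemigroup = record
      { isCommutativeSemigroup = IsAbelianGroup.isCommutativeSemigroup +ₚ-isAbelianGroup }

    open CommutativeSemigroupProperties +ₚ-commutativeSemigroup
      using () renaming (interchange to +ₚ-interchange; x∙yz≈y∙xz to +ₚ-swap)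

  ·ₚ-zeroˡ : ∀ {c} p → c ≈ 0# → c ·ₚ p ≈ₚ []
  at (·ₚ-zeroˡ {c} p c≈0) i =
    R.trans (coeff-· c p i) (R.trans (R.*-congʳ c≈0) (R.zeroˡ _))

  ·ₚ-identity : ∀ p → 1# ·ₚ p ≈ₚ p
  at (·ₚ-identity p) i = R.trans (coeff-· 1# p i) (R.*-identityˡ _)

  ·ₚ-assoc : ∀ c e p → (c * e) ·ₚ p ≈ₚ c ·ₚ (e ·ₚ p)
  at (·ₚ-assoc c e p) i =
    R.trans (coeff-· (c * e) p i)
      (R.trans (R.*-assoc _ _ _)
        (R.trans (R.*-congˡ (R.sym (coeff-· e p i)))
          (R.sym (coeff-· c (e ·ₚ p) i))))

  ·ₚ-distribˡ : ∀ c p q → c ·ₚ (p +ₚ q) ≈ₚ c ·ₚ p +ₚ c ·ₚ q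
  at (·ₚ-distribˡ c p q) i =
    R.trans (coeff-· c (p +ₚ q) i)
      (R.trans (R.*-congˡ (coeff-+ p q i))
        (R.trans (R.distribˡ _ _ _)
          (R.trans (R.+-cong (R.sym (coeff-· c p i)) (R.sym (coeff-· c q i)))
            (R.sym (coeff-+ (c ·ₚ p) (c ·ₚ q) i)))))

  ·ₚ-distribʳ : ∀ c e p → (c + e) ·ₚ p ≈ₚ c ·ₚ p +ₚ e ·ₚ p
  at (·ₚ-distribʳ c e p) i =
    R.trans (coeff-· (c + e) p i)
      (R.trans (R.distribʳ _ _ _)
        (R.trans (R.+-cong (R.sym (coeff-· c p i)) (R.sym (coeff-· e p i)))
          (R.sym (coeff-+ (c ·ₚ p) (e ·ₚ p) i))))

  shift-+ : ∀ p q → 0# ∷ p +ₚ q ≈ₚ (0# ∷ p) +ₚ (0# ∷ q)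
  shift-+ p q = ∷-cong (R.sym (R.+-identityˡ 0#)) reflₚ

  *ₚ-congˡ : ∀ p {q q′} → q ≈ₚ q′ → p *ₚ q ≈ₚ p *ₚ q′
  *ₚ-congˡ []      e = reflₚ
  *ₚ-congˡ (c ∷ p) e = +ₚ-cong (·ₚ-cong R.refl e) (∷-cong R.refl (*ₚ-congˡ p e))

  *ₚ-zeroˡ : ∀ p q → p ≈ₚ [] → p *ₚ q ≈ₚ []
  *ₚ-zeroˡ []      q e = reflₚ
  *ₚ-zeroˡ (c ∷ p) q e =
    +ₚ-cong (·ₚ-zeroˡ q (at e 0)) (∷-zero R.refl (*ₚ-zeroˡ p q (tail-zero e)))

  *ₚ-congʳ : ∀ {p p′} q → p ≈ₚ p′ → p *ₚ q ≈ₚ p′ *ₚ q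
  *ₚ-congʳ {[]}    {p′}     q e = symₚ (*ₚ-zeroˡ p′ q (symₚ e))
  *ₚ-congʳ {c ∷ p} {[]}     q e = *ₚ-zeroˡ (c ∷ p) q e
  *ₚ-congʳ {c ∷ p} {e ∷ p′} q f =
    +ₚ-cong (·ₚ-cong (at f 0) reflₚ) (∷-cong R.refl (*ₚ-congʳ q (tail-cong f)))

  *ₚ-cong : ∀ {p p′ q q′} → p ≈ₚ p′ → q ≈ₚ q′ → p *ₚ q ≈ₚ p′ *ₚ q′
  *ₚ-cong {p′ = p′} {q = q} e f = transₚ (*ₚ-congʳ q e) (*ₚ-congˡ p′ f)

  *ₚ-zeroʳ : ∀ p → p *ₚ [] ≈ₚ []
  *ₚ-zeroʳ []      = reflₚ
  *ₚ-zeroʳ (c ∷ p) = ∷-zero R.refl (*ₚ-zeroʳ p)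

  *ₚ-distribʳ : ∀ q p p′ → (p +ₚ p′) *ₚ q ≈ₚ p *ₚ q +ₚ p′ *ₚ q
  *ₚ-distribʳ q []      p′       = reflₚ
  *ₚ-distribʳ q (c ∷ p) []       = symₚ (+ₚ-identityʳ _)
  *ₚ-distribʳ q (c ∷ p) (e ∷ p′) =
    transₚ
      (+ₚ-cong (·ₚ-distribʳ c e q)
        (transₚ (∷-cong R.refl (*ₚ-distribʳ q p p′)) (shift-+ (p *ₚ q) (p′ *ₚ q))))
      (+ₚ-interchange (c ·ₚ q) (e ·ₚ q) (0# ∷ p *ₚ q) (0# ∷ p′ *ₚ q))

  ·ₚ-*ₚ-assoc : ∀ c p q → (c ·ₚ p) *ₚ q ≈ₚ c ·ₚ (p *ₚ q)
  ·ₚ-*ₚ-assoc c []      q = reflₚ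
  ·ₚ-*ₚ-assoc c (e ∷ p) q =
    transₚ
      (+ₚ-cong (·ₚ-assoc c e q)
        (∷-cong (R.sym (R.zeroʳ c)) (·ₚ-*ₚ-assoc c p q)))
      (symₚ (·ₚ-distribˡ c (e ·ₚ q) (0# ∷ p *ₚ q)))

  shift-*ₚ : ∀ {c} p q → c ≈ 0# → (c ∷ p) *ₚ q ≈ₚ 0# ∷ p *ₚ q
  shift-*ₚ p q c≈0 = +ₚ-cong (·ₚ-zeroˡ q c≈0) (reflₚ {0# ∷ p *ₚ q})

  *ₚ-assoc : ∀ p q r → (p *ₚ q) *ₚ r ≈ₚ p *ₚ (q *ₚ r)
  *ₚ-assoc []      q r = reflₚ
  *ₚ-assoc (c ∷ p) q r =
    transₚ (*ₚ-distribʳ r (c ·ₚ q) (0# ∷ p *ₚ q))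
      (+ₚ-cong (·ₚ-*ₚ-assoc c q r)
        (transₚ (shift-*ₚ (p *ₚ q) r R.refl) (∷-cong R.refl (*ₚ-assoc p q r))))

  *ₚ-∷ : ∀ p c q → p *ₚ (c ∷ q) ≈ₚ c ·ₚ p +ₚ (0# ∷ p *ₚ q)
  *ₚ-∷ []      c q = symₚ (∷-zero R.refl reflₚ)
  *ₚ-∷ (e ∷ p) c q =
    ∷-cong (R.+-congʳ (R.*-comm e c))
      (transₚ (+ₚ-cong (reflₚ {e ·ₚ q}) (*ₚ-∷ p c q))
        (+ₚ-swap (e ·ₚ q) (c ·ₚ p) (0# ∷ p *ₚ q)))

  *ₚ-comm : ∀ p q → p *ₚ q ≈ₚ q *ₚ p
  *ₚ-comm []      q = symₚ (*ₚ-zeroʳ q)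
  *ₚ-comm (c ∷ p) q =
    transₚ (+ₚ-cong (reflₚ {c ·ₚ q}) (∷-cong R.refl (*ₚ-comm p q)))
      (symₚ (*ₚ-∷ q c p))

  *ₚ-identityˡ : ∀ p → 1ₚ *ₚ p ≈ₚ p
  *ₚ-identityˡ p =
    transₚ (+ₚ-cong (·ₚ-identity p) (∷-zero R.refl reflₚ)) (+ₚ-identityʳ p)

  *ₚ-identityʳ : ∀ p → p *ₚ 1ₚ ≈ₚ p
  *ₚ-identityʳ p = transₚ (*ₚ-comm p 1ₚ) (*ₚ-identityˡ p)

  *ₚ-distribˡ : ∀ p q r → p *ₚ (q +ₚ r) ≈ₚ p *ₚ q +ₚ p *ₚ r
  *ₚ-distribˡ p q r =
    transₚ (*ₚ-comm p (q +ₚ r))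
      (transₚ (*ₚ-distribʳ p q r) (+ₚ-cong (*ₚ-comm q p) (*ₚ-comm r p)))

  polyRing : CommutativeRing c ℓ
  polyRing = record
    { Carrier = Poly
    ; _≈_ = _≈ₚ_
    ; _+_ = _+ₚ_
    ; _*_ = _*ₚ_
    ; -_  = -ₚ_
    ; 0#  = 0ₚ
    ; 1#  = 1ₚ
    ; isCommutativeRing = record
      { isRing = record
        { +-isAbelianGroup = +ₚ-isAbelianGroup
        ; *-cong     = *ₚ-cong
        ; *-assoc    = *ₚ-assoc
        ; *-identity = *ₚ-identityˡ , *ₚ-identityʳ
        ; distrib    = *ₚ-distribˡ , *ₚ-distribʳ
        }
      ; *-comm = *ₚ-comm
      }
    }

module PolynomialDomain {c ℓ} (D : IntegralDomain c ℓ) where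

  private module D = IntegralDomain D
  open Polynomial D.commutativeRing public

  _≟ₚ_ : Decidable _≈ₚ_
  []      ≟ₚ []      = yes (coeffs λ _ → D.refl)
  []      ≟ₚ (e ∷ q) with D.0# D.≟ e | [] ≟ₚ q
  ... | yes h | yes t = yes (coeffs λ { zero → h ; (suc i) → at t i })
  ... | no ¬h | _     = no λ f → ¬h (at f 0)
  ... | _     | no ¬t = no λ f → ¬t (coeffs (at f ∘ suc))
  (c ∷ p) ≟ₚ []      with c D.≟ D.0# | p ≟ₚ []
  ... | yes h | yes t = yes (∷-zero h t)
  ... | no ¬h | _     = no λ f → ¬h (at f 0)
  ... | _     | no ¬t = no λ f → ¬t (tail-zero f)
  (c ∷ p) ≟ₚ (e ∷ q) with c D.≟ e | p ≟ₚ q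
  ... | yes h | yes t = yes (∷-cong h t)
  ... | no ¬h | _     = no λ f → ¬h (at f 0)
  ... | _     | no ¬t = no λ f → ¬t (tail-cong f)

  private module P = CommutativeRing polyRing

  *ₚ-cancel : ∀ {c} p q → ¬ c D.≈ D.0# → (c ∷ p) *ₚ q ≈ₚ 0ₚ → q ≈ₚ 0ₚ
  *ₚ-cancel         p []      c≉0 e = P.refl
  *ₚ-cancel {c = c} p (f ∷ q) c≉0 e = ∷-zero f≈0 (*ₚ-cancel p q c≉0 (tail-zero
    (P.trans (P.sym (P.trans (*ₚ-comm (c ∷ p) (f ∷ q))
      (P.trans (shift-*ₚ q (c ∷ p) f≈0) (∷-cong D.refl (*ₚ-comm q (c ∷ p)))))) e)))
    where
    f≈0 : f D.≈ D.0#
    f≈0 = [ (λ c≈0 → contradiction c≈0 c≉0) , id ]′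
      (D.noZeroDivisors c f (D.trans (D.sym (D.+-identityʳ _)) (at e 0)))

  *ₚ-noZeroDivisors : ∀ p q → p *ₚ q ≈ₚ 0ₚ → p ≈ₚ 0ₚ ⊎ q ≈ₚ 0ₚ
  *ₚ-noZeroDivisors []      q e = inj₁ e
  *ₚ-noZeroDivisors (c ∷ p) q e with c D.≟ D.0#
  ... | yes c≈0 = map₁ (∷-zero c≈0)
    (*ₚ-noZeroDivisors p q (tail-zero (P.trans (P.sym (shift-*ₚ p q c≈0)) e)))
  ... | no c≉0  = inj₂ (*ₚ-cancel p q c≉0 e)

  polyDomain : IntegralDomain c ℓ
  polyDomain = record
    { commutativeRing = polyRing
    ; _≟_             = _≟ₚ_
    ; 1≉0             = λ e → D.1≉0 (at e 0)
    ; noZeroDivisors  = *ₚ-noZeroDivisors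
    }

module FractionField {c ℓ} (D : IntegralDomain c ℓ) where

  private
    open module D = IntegralDomain D using (_≈_; _≉_; _+_; _*_; -_; 0#; 1#)
    open RingProperties D.ring using (-‿distribˡ-*)
    open SemiringSolver D.commutativeSemiring
      using (solve) renaming (_:+_ to _⊕_; _:*_ to _⊗_; _:=_ to _⊜_)
    open module ≈-Reasoning = SetoidReasoning D.setoid

  record Frac : Set (c ⊔ ℓ) where
    constructor frac
    field
      num den : D.Carrier
      den≉0   : den ≉ 0#
  open Frac public

  infix 4 _≃_
  record _≃_ (x y : Frac) : Set ℓ where
    constructor cross
    field uncross : num x * den y ≈ num y * den x
  open _≃_ public

  *-≉0 : ∀ {x y} → x ≉ 0# → y ≉ 0# → x * y ≉ 0#
  *-≉0 {x} {y} x≉0 y≉0 e = [ x≉0 , y≉0 ]′ (D.noZeroDivisors x y e)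

  *-cancelʳ : ∀ {x y} z → z ≉ 0# → x * z ≈ y * z → x ≈ y
  *-cancelʳ {x} {y} z z≉0 e with D.noZeroDivisors (x + - y) z eq
    where
    eq : (x + - y) * z ≈ 0#
    eq = D.trans (D.distribʳ z x (- y)) (D.trans
      (D.+-congʳ e) (D.trans (D.sym (D.distribʳ z y (- y)))
        (D.trans (D.*-congʳ (D.-‿inverseʳ y)) (D.zeroˡ z))))
  ... | inj₁ x-y≈0 = GroupProperties.x∙y⁻¹≈ε⇒x≈y D.+-group x y x-y≈0
  ... | inj₂ z≈0   = contradiction z≈0 z≉0

  fromDomain : D.Carrier → Frac
  fromDomain x = frac x 1# D.1≉0

  0F 1F : Frac
  0F = fromDomain 0#
  1F = fromDomain 1#

  infixl 6 _+F_
  infixl 7 _*F_ _/F_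
  infix  8 -F_
  infix  9 _⁻¹

  _+F_ _*F_ _/F_ : Frac → Frac → Frac
  frac a b b≉0 +F frac c d d≉0 = frac (a * d + c * b) (b * d) (*-≉0 b≉0 d≉0)
  frac a b b≉0 *F frac c d d≉0 = frac (a * c) (b * d) (*-≉0 b≉0 d≉0)

  -F_ : Frac → Frac
  -F frac a b b≉0 = frac (- a) b b≉0

  -- Totalised by 0 ⁻¹ = 0.
  _⁻¹ : Frac → Frac
  frac a b b≉0 ⁻¹ with a D.≟ 0#
  ... | yes _  = 0F
  ... | no a≉0 = frac b a a≉0

  x /F y = x *F y ⁻¹

  ≃-isEquivalence : IsEquivalence _≃_
  ≃-isEquivalence = record
    { refl  = cross D.refl
    ; sym   = λ (cross e) → cross (D.sym e)
    ; trans = λ {x} {y} {z} → ≃-trans x y z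
    }
    where
    ≃-trans : ∀ x y z → x ≃ y → y ≃ z → x ≃ z
    ≃-trans (frac a b _) (frac c d d≉0) (frac e f _) (cross g) (cross h) =
      cross (*-cancelʳ d d≉0 (begin
        (a * f) * d ≈⟨ solve 3 (λ a f d → (a ⊗ f) ⊗ d ⊜ (a ⊗ d) ⊗ f) D.refl a f d ⟩
        (a * d) * f ≈⟨ D.*-congʳ g ⟩
        (c * b) * f ≈⟨ solve 3 (λ c b f → (c ⊗ b) ⊗ f ⊜ (c ⊗ f) ⊗ b) D.refl c b f ⟩
        (c * f) * b ≈⟨ D.*-congʳ h ⟩
        (e * d) * b ≈⟨ solve 3 (λ e d b → (e ⊗ d) ⊗ b ⊜ (e ⊗ b) ⊗ d) D.refl e d b ⟩
        (e * b) * d ∎))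

  +F-cong : ∀ {x x′ y y′} → x ≃ x′ → y ≃ y′ → x +F y ≃ x′ +F y′
  +F-cong {frac a b _} {frac a′ b′ _} {frac c d _} {frac c′ d′ _} (cross e) (cross f) =
    cross (begin
      (a * d + c * b) * (b′ * d′)
        ≈⟨ solve 6 (λ a b c d b′ d′ →
             (a ⊗ d ⊕ c ⊗ b) ⊗ (b′ ⊗ d′) ⊜ (a ⊗ b′) ⊗ (d ⊗ d′) ⊕ (c ⊗ d′) ⊗ (b ⊗ b′))
             D.refl a b c d b′ d′ ⟩
      (a * b′) * (d * d′) + (c * d′) * (b * b′)
        ≈⟨ D.+-cong (D.*-congʳ e) (D.*-congʳ f) ⟩
      (a′ * b) * (d * d′) + (c′ * d) * (b * b′)
        ≈⟨ solve 6 (λ a′ b c′ d b′ d′ →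
             (a′ ⊗ b) ⊗ (d ⊗ d′) ⊕ (c′ ⊗ d) ⊗ (b ⊗ b′) ⊜ (a′ ⊗ d′ ⊕ c′ ⊗ b′) ⊗ (b ⊗ d))
             D.refl a′ b c′ d b′ d′ ⟩
      (a′ * d′ + c′ * b′) * (b * d) ∎)

  *F-cong : ∀ {x x′ y y′} → x ≃ x′ → y ≃ y′ → x *F y ≃ x′ *F y′
  *F-cong {frac a b _} {frac a′ b′ _} {frac c d _} {frac c′ d′ _} (cross e) (cross f) =
    cross (begin
      (a * c) * (b′ * d′)
        ≈⟨ solve 4 (λ a c b′ d′ → (a ⊗ c) ⊗ (b′ ⊗ d′) ⊜ (a ⊗ b′) ⊗ (c ⊗ d′))
             D.refl a c b′ d′ ⟩
      (a * b′) * (c * d′)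
        ≈⟨ D.*-cong e f ⟩
      (a′ * b) * (c′ * d)
        ≈⟨ solve 4 (λ a′ b c′ d → (a′ ⊗ b) ⊗ (c′ ⊗ d) ⊜ (a′ ⊗ c′) ⊗ (b ⊗ d))
             D.refl a′ b c′ d ⟩
      (a′ * c′) * (b * d) ∎)

  -F-cong : ∀ {x y} → x ≃ y → -F x ≃ -F y
  -F-cong {frac a b _} {frac c d _} (cross e) = cross (begin
    - a * d   ≈⟨ -‿distribˡ-* a d ⟨
    - (a * d) ≈⟨ D.-‿cong e ⟩
    - (c * b) ≈⟨ -‿distribˡ-* c b ⟩
    - c * b   ∎)

  ⁻¹-inverseʳ : ∀ x → ¬ x ≃ 0F → x *F x ⁻¹ ≃ 1F
  ⁻¹-inverseʳ (frac a b b≉0) x≄0 with a D.≟ 0#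
  ... | yes a≈0 = contradiction
    (cross (D.trans (D.*-identityʳ a) (D.trans a≈0 (D.sym (D.zeroˡ b))))) x≄0
  ... | no _ = cross (D.trans (D.*-identityʳ _)
    (D.trans (D.*-comm a b) (D.sym (D.*-identityˡ _))))

  +F-assoc : ∀ x y z → (x +F y) +F z ≃ x +F (y +F z)
  +F-assoc (frac a b _) (frac c d _) (frac e f _) = cross (solve 6 (λ a b c d e f →
    ((a ⊗ d ⊕ c ⊗ b) ⊗ f ⊕ e ⊗ (b ⊗ d)) ⊗ (b ⊗ (d ⊗ f)) ⊜
    (a ⊗ (d ⊗ f) ⊕ (c ⊗ f ⊕ e ⊗ d) ⊗ b) ⊗ ((b ⊗ d) ⊗ f)) D.refl a b c d e f)

  +F-comm : ∀ x y → x +F y ≃ y +F x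
  +F-comm (frac a b _) (frac c d _) = cross (solve 4 (λ a b c d →
    (a ⊗ d ⊕ c ⊗ b) ⊗ (d ⊗ b) ⊜ (c ⊗ b ⊕ a ⊗ d) ⊗ (b ⊗ d)) D.refl a b c d)

  +F-identityˡ : ∀ x → 0F +F x ≃ x
  +F-identityˡ (frac a b _) = cross (begin
    (0# * b + a * 1#) * b ≈⟨ D.*-congʳ (D.+-cong (D.zeroˡ b) (D.*-identityʳ a)) ⟩
    (0# + a) * b          ≈⟨ D.*-cong (D.+-identityˡ a) (D.sym (D.*-identityˡ b)) ⟩
    a * (1# * b)          ∎)

  +F-inverseˡ : ∀ x → -F x +F x ≃ 0F
  +F-inverseˡ (frac a b _) = cross (begin
    (- a * b + a * b) * 1# ≈⟨ D.*-identityʳ _ ⟩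
    - a * b + a * b        ≈⟨ D.distribʳ b (- a) a ⟨
    (- a + a) * b          ≈⟨ D.*-congʳ (D.-‿inverseˡ a) ⟩
    0# * b                 ≈⟨ D.trans (D.zeroˡ b) (D.sym (D.zeroˡ (b * b))) ⟩
    0# * (b * b)           ∎)

  *F-assoc : ∀ x y z → (x *F y) *F z ≃ x *F (y *F z)
  *F-assoc (frac a b _) (frac c d _) (frac e f _) =
    cross (D.*-cong (D.*-assoc a c e) (D.sym (D.*-assoc b d f)))

  *F-comm : ∀ x y → x *F y ≃ y *F x
  *F-comm (frac a b _) (frac c d _) = cross (D.*-cong (D.*-comm a c) (D.*-comm d b))

  *F-identityˡ : ∀ x → 1F *F x ≃ x
  *F-identityˡ (frac a b _) =
    cross (D.*-cong (D.*-identityˡ a) (D.sym (D.*-identityˡ b)))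

  *F-distribˡ : ∀ x y z → x *F (y +F z) ≃ x *F y +F x *F z
  *F-distribˡ (frac a b _) (frac c d _) (frac e f _) = cross (solve 6 (λ a b c d e f →
    (a ⊗ (c ⊗ f ⊕ e ⊗ d)) ⊗ ((b ⊗ d) ⊗ (b ⊗ f)) ⊜
    ((a ⊗ c) ⊗ (b ⊗ f) ⊕ (a ⊗ e) ⊗ (b ⊗ d)) ⊗ (b ⊗ (d ⊗ f))) D.refl a b c d e f)

  private
    open module ≃ = IsEquivalence ≃-isEquivalence
      using () renaming (trans to ≃-trans)

  fracRing : CommutativeRing (c ⊔ ℓ) ℓ
  fracRing = record
    { Carrier = Frac
    ; _≈_ = _≃_
    ; _+_ = _+F_
    ; _*_ = _*F_
    ; -_  = -F_
    ; 0#  = 0F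
    ; 1#  = 1F
    ; isCommutativeRing = record
      { isRing = record
        { +-isAbelianGroup = record
          { isGroup = record
            { isMonoid = record
              { isSemigroup = record
                { isMagma = record { isEquivalence = ≃-isEquivalence ; ∙-cong = +F-cong }
                ; assoc = +F-assoc
                }
              ; identity = +F-identityˡ , λ x → ≃-trans (+F-comm x 0F) (+F-identityˡ x)
              }
            ; inverse = +F-inverseˡ , λ x → ≃-trans (+F-comm x (-F x)) (+F-inverseˡ x)
            ; ⁻¹-cong = -F-cong
            }
          ; comm = +F-comm
          }
        ; *-cong     = *F-cong
        ; *-assoc    = *F-assoc
        ; *-identity = *F-identityˡ , λ x → ≃-trans (*F-comm x 1F) (*F-identityˡ x)
        ; distrib    = *F-distribˡ , λ x y z → ≃-trans (*F-comm (y +F z) x)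
            (≃-trans (*F-distribˡ x y z) (+F-cong (*F-comm x y) (*F-comm x z)))
        }
      ; *-comm = *F-comm
      }
    }

ℚ-domain : IntegralDomain 0ℓ 0ℓ
ℚ-domain = record
  { commutativeRing = ℚₚ.+-*-commutativeRing
  ; _≟_             = ℚₚ._≟_
  ; 1≉0             = ℚₚ.1≢0
  ; noZeroDivisors  = noZeroDivisors
  }
  where
  noZeroDivisors : ∀ x y → x ℚ.* y ≡ ℚ.0ℚ → x ≡ ℚ.0ℚ ⊎ y ≡ ℚ.0ℚ
  noZeroDivisors x y e with x ℚₚ.≟ ℚ.0ℚ
  ... | yes x≡0 = inj₁ x≡0
  ... | no x≢0  = inj₂ (begin
    y                        ≡⟨ ℚₚ.*-identityˡ y ⟨
    ℚ.1ℚ ℚ.* y               ≡⟨ ≡.cong (ℚ._* y) (ℚₚ.*-inverseˡ x) ⟨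
    (ℚ.1/ x ℚ.* x) ℚ.* y     ≡⟨ ℚₚ.*-assoc (ℚ.1/ x) x y ⟩
    ℚ.1/ x ℚ.* (x ℚ.* y)     ≡⟨ ≡.cong (ℚ.1/ x ℚ.*_) e ⟩
    ℚ.1/ x ℚ.* ℚ.0ℚ          ≡⟨ ℚₚ.*-zeroʳ (ℚ.1/ x) ⟩
    ℚ.0ℚ                     ∎)
    where
    open ≡-Reasoning
    instance _ = ℚ.≢-nonZero x≢0

module ℚ[q]     = PolynomialDomain ℚ-domain
module ℚ[q,a]   = PolynomialDomain ℚ[q].polyDomain
module ℚ[q,a,b] = PolynomialDomain ℚ[q,a].polyDomain
module ℚ⟨q,a,b⟩ = FractionField ℚ[q,a,b].polyDomain

open IntegralDomain ℚ[q,a,b].polyDomain public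
  using () renaming (Carrier to Polynomials; semiring to polynomialSemiring)
open RawSemiringDefinitions (Semiring.rawSemiring polynomialSemiring) public using (Coprime)

open CommutativeRing ℚ⟨q,a,b⟩.fracRing public
  using (_≈_; _+_; _*_; _-_; -_; 0#; 1#)
  renaming (Carrier to RationalFunctions; semiring to rationalSemiring)
open RawSemiringDefinitions (Semiring.rawSemiring rationalSemiring) public using (sum; _^_)
open ℚ⟨q,a,b⟩ public using (_⁻¹; frac; num; den; den≉0)
  renaming (_/F_ to infixl 7 _/_; fromDomain to fromPolynomial)

q a b : RationalFunctions
q = fromPolynomial (ℚ[q,a,b].const (ℚ[q,a].const ℚ[q].X))
a = fromPolynomial (ℚ[q,a,b].const ℚ[q,a].X)
b = fromPolynomial ℚ[q,a,b].X

infixr 8 _^ℤ_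
_^ℤ_ : RationalFunctions → ℤ → RationalFunctions
x ^ℤ (+ m)    = x ^ m
x ^ℤ -[1+ m ] = (x ⁻¹) ^ suc m

infix 9 ⦅_⸴_⦆_ ⟨_⟩_
infix 4 _≡_[modₚ_] _≡_[mod_] _IsNumeratorOf_

-- ⦅ x ⸴ y ⦆ m is the shifted factorial (x;y)ₘ.
⦅_⸴_⦆_ : RationalFunctions → RationalFunctions → ℕ → RationalFunctions
⦅ x ⸴ y ⦆ zero  = 1#
⦅ x ⸴ y ⦆ suc m = ⦅ x ⸴ y ⦆ m * (1# - x * y ^ m)

-- ∑[ s ≤k< n ] f = f s + f (s + 1) + ⋯ + f (n - 1).
∑[_≤k<_] : ℕ → ℕ → (ℕ → RationalFunctions) → RationalFunctions
∑[ s ≤k< n ] f = sum {n ∸ s} (λ i → f (s ℕ.+ toℕ i))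

-- The smallest j < m such that m divides the numerator of x - j. One exists
-- when the denominator of x is coprime to m; the value is 0 if there is none.
⟨_⟩_ : ℚ → ℕ → ℕ
⟨ x ⟩ m = fromMaybe 0 (head (filter (λ j → m ∣? ℤ.∣ ↥ (x ℚ.- (+ j) ℚ./ 1) ∣) (upTo m)))

_≡_[modₚ_] : RationalFunctions → RationalFunctions → Polynomials → Set
A ≡ B [modₚ P ] =
  ∃[ C ] ∃[ D ] Σ (¬ D ℚ[q,a,b].≈ₚ ℚ[q,a,b].0ₚ) λ D≉0 →
    Coprime D P × A - B ≈ fromPolynomial P * frac C D D≉0

-- P is the numerator of F in lowest terms (unique up to a unit).
_IsNumeratorOf_ : Polynomials → RationalFunctions → Set
P IsNumeratorOf F =
  ∃[ M ] Σ (¬ M ℚ[q,a,b].≈ₚ ℚ[q,a,b].0ₚ) λ M≉0 → Coprime P M × F ≈ frac P M M≉0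

-- For F a polynomial this is the congruence modulo F. In general F may have a
-- power of q in its denominator (1 - b qᵉ with e < 0), which is a factor
-- irrelevant to the congruence and is cleared first.
_≡_[mod_] : RationalFunctions → RationalFunctions → RationalFunctions → Set
A ≡ B [mod F ] = ∃[ P ] P IsNumeratorOf F × A ≡ B [modₚ P ]

{-# OPTIONS --safe #-}
-- Put Q = q^d, x = a q^r, y = b q^(d-r), and let T(s,k) be the summand and
-- f(s) the sum of T(s,k) over s ≤ k < n. With z = Q^s there is a two-step
-- recurrence
--   (1 - xz)(1 - yz) f(s) = z² (x - zQ²)(y - zQ²) f(s+2) + (x;Q)ₙ (y;Q)ₙ C(s),
-- because the difference of the summands telescopes in k. Since f vanishes
-- for s ≥ n, f(s) is (x;Q)ₙ (y;Q)ₙ times a rational function whose denominator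
-- is a product of factors q, 1 - q^i, 1 - ab q^i, 1 - x Q^s′ and 1 - y Q^s′
-- with s′ ≡ s (mod 2).
-- Writing t and t′ for the two residues in the modulus, t + t′ + 1 = n, so for
-- odd n they have the same parity, opposite to that of s. Hence the moduli
-- 1 - x Q^t and 1 - y Q^t′, which are factors of (x;Q)ₙ and (y;Q)ₙ and primes
-- up to a power of q, do not divide the denominator.
module Submission where

open import Algebra.Bundles using (CommutativeRing; Semiring)
import Algebra.Definitions.RawMagma as RawMagmaDefinitions
import Algebra.Definitions.RawSemiring as RawSemiringDefinitions
import Algebra.Properties.AbelianGroup as AbelianGroupProperties
import Algebra.Properties.CommutativeSemiring.Exp as CommutativeSemiringExp
import Algebra.Properties.Ring as RingProperties
import Algebra.Properties.Semiring.Exp as SemiringExp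
import Algebra.Properties.Semiring.Mult.TCOptimised as SemiringMult
import Algebra.Properties.Semiring.Sum as SemiringSum
import Algebra.Solver.Ring as RingSolver
open import Algebra.Solver.Ring.AlmostCommutativeRing using (_-Raw-AlmostCommutative⟶_; fromCommutativeRing)
open import Data.Fin.Base using (toℕ)
open import Data.Integer.Base as ℤ using (ℤ; +_; -[1+_]; _⊖_)
open import Data.Integer.GCD using () renaming (gcd to gcdℤ)
import Data.Integer.Properties as ℤₚ
import Data.Integer.Tactic.RingSolver as ℤ-Solver
open import Data.List.Base using ([]; _∷_; head; upTo)
open import Data.List.Membership.Propositional using (_∈_)
open import Data.List.Membership.Propositional.Properties using (∈-filter⁺; ∈-filter⁻; ∈-upTo⁺; ∈-upTo⁻)
open import Data.List.Relation.Unary.Any using (here)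
open import Data.Maybe.Base using (Maybe; fromMaybe; map)
open import Data.Nat.Base as ℕ using (ℕ; zero; suc; NonZero; _≤_; _<_; _∸_)
open import Data.Nat.Coprimality as Coprimality using (coprime-Bézout; coprime-divisor)
open import Data.Nat.DivMod using (_%_; m%n<n; %-distribˡ-+; [m+kn]%n≡m%n)
open import Data.Nat.GCD using (gcd; module Bézout; gcd[m,n]∣n)
import Data.Nat.Properties as ℕₚ
import Data.Nat.Tactic.RingSolver as ℕ-Solver
open import Data.Product.Base using (Σ; Σ-syntax; ∃-syntax; _×_; _,_; proj₁; proj₂)
open import Data.Rational.Base as ℚ using (↥_; toℚᵘ)
import Data.Rational.Properties as ℚₚ
open import Data.Rational.Unnormalised.Base as ℚᵘ using (mkℚᵘ; *≡*) renaming (_≃_ to _≃ᵘ_)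
import Data.Rational.Unnormalised.Properties as ℚᵘₚ
open import Data.Sum.Base using (_⊎_; inj₁; inj₂; [_,_]′) renaming (map to ⊎-map)
open import Defs using (IntegralDomain; module PolynomialDomain; module FractionField; ⟨_⟩_)
open import Level using (_⊔_) renaming (suc to lsuc)
open import Relation.Binary.Consequences using (dec⇒weaklyDec)
open import Relation.Binary.PropositionalEquality.Core as ≡ using (_≡_; _≢_)
open import Relation.Binary.PropositionalEquality.Properties using (module ≡-Reasoning)
import Relation.Binary.Reasoning.Setoid as SetoidReasoning
open import Relation.Nullary.Decidable using (map′)
open import Relation.Nullary.Negation using (¬_; contradiction)
open import Relation.Unary using () renaming (Decidable to Decidable₁)

-- The factor (x;Q)ₙ (y;Q)ₙ is a boundary term: at the lower end of the telescoping 1/(Q;Q) has a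
-- negative index and vanishes, while the upper end k = n - 1 carries the factorials of index n.
-- Both moduli therefore divide the sum at once, and neither `a` nor `b` is ever specialised in it.
-- Denominators are never computed. They only have to avoid two primes, so the induction on s runs
-- inside an abstract subring, later taken to be the fractions with a denominator divisible by
-- neither prime. Each division in the recurrence then needs just a unit of that subring. A modulus
-- is linear in `a` or in `b`, so divisibility by it is tested by substituting a power of q for that
-- variable and clearing denominators. As r may exceed d, the exponent of q next to `b` may be
-- negative. The prime is then q^m - b instead of 1 - b q^m′, and the modulus of the theorem differs
-- from it by q^m, a unit of the subring.

-- Ring identities with integer coefficients

module IntegerSolver {c ℓ} (R : CommutativeRing c ℓ) where

  private
    open module R = CommutativeRing R using (_≈_; _+_; _*_; -_; _-_; 0#; 1#)
    open RingProperties R.ring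
      using (-0#≈0#; -‿involutive; -‿distribˡ-*; -‿distribʳ-*)
    open AbelianGroupProperties R.+-abelianGroup using (⁻¹-∙-comm)
    open SemiringMult R.semiring using (×-homo-+; ×1-homo-*; 1+×) renaming (_×_ to infixl 8 _·_)
    open SetoidReasoning R.setoid

    -- The canonical map from ℤ. Coefficients with decidable equality let the solver cancel opposite
    -- terms although equality in `R` need not be decidable.
    ⟦_⟧ : ℤ → R.Carrier
    ⟦ + n ⟧      = n · 1#
    ⟦ -[1+ n ] ⟧ = - (suc n · 1#)

    ⟦⟧-neg : ∀ i → ⟦ ℤ.- i ⟧ ≈ - ⟦ i ⟧
    ⟦⟧-neg (+ zero)  = R.sym -0#≈0#
    ⟦⟧-neg (+ suc n) = R.refl
    ⟦⟧-neg -[1+ n ]  = R.sym (-‿involutive _)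

    ⟦⟧-⊖ : ∀ m n → ⟦ m ⊖ n ⟧ ≈ m · 1# - n · 1#
    ⟦⟧-⊖ m zero = R.sym (R.trans (R.+-congˡ -0#≈0#) (R.+-identityʳ _))
    ⟦⟧-⊖ zero (suc n) = R.sym (R.+-identityˡ _)
    ⟦⟧-⊖ (suc m) (suc n) = begin
      ⟦ suc m ⊖ suc n ⟧                    ≡⟨ ≡.cong ⟦_⟧ (ℤₚ.[1+m]⊖[1+n]≡m⊖n m n) ⟩
      ⟦ m ⊖ n ⟧                            ≈⟨ ⟦⟧-⊖ m n ⟩
      x - y                                ≈⟨ R.+-congˡ (R.+-identityˡ _) ⟨
      x + (0# - y)                         ≈⟨ R.+-congˡ (R.+-congʳ (R.-‿inverseʳ 1#)) ⟨
      x + ((1# - 1#) - y)                  ≈⟨ R.+-congˡ (R.+-assoc _ _ _) ⟩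
      x + (1# + (- 1# - y))                ≈⟨ R.+-assoc _ _ _ ⟨
      (x + 1#) + (- 1# - y)                ≈⟨ R.+-cong (R.+-comm x 1#) (⁻¹-∙-comm 1# y) ⟩
      (1# + x) - (1# + y)                  ≈⟨ R.+-cong (1+× m 1#) (R.-‿cong (1+× n 1#)) ⟨
      suc m · 1# - suc n · 1#              ∎
      where
      x = m · 1#
      y = n · 1#

    ⟦⟧-+ : ∀ i j → ⟦ i ℤ.+ j ⟧ ≈ ⟦ i ⟧ + ⟦ j ⟧
    ⟦⟧-+ (+ m) (+ n)           = ×-homo-+ 1# m n
    ⟦⟧-+ (+ m) -[1+ n ]        = ⟦⟧-⊖ m (suc n)
    ⟦⟧-+ -[1+ m ] (+ n)        = R.trans (⟦⟧-⊖ n (suc m)) (R.+-comm _ _)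
    ⟦⟧-+ -[1+ m ] -[1+ n ]     = begin
      ⟦ -[1+ m ] ℤ.+ -[1+ n ] ⟧          ≡⟨ ≡.cong ⟦_⟧ (ℤₚ.neg-distrib-+ (+ suc m) (+ suc n)) ⟨
      ⟦ ℤ.- (+ (suc m ℕ.+ suc n)) ⟧      ≈⟨ ⟦⟧-neg (+ (suc m ℕ.+ suc n)) ⟩
      - ((suc m ℕ.+ suc n) · 1#)         ≈⟨ R.-‿cong (×-homo-+ 1# (suc m) (suc n)) ⟩
      - (suc m · 1# + suc n · 1#)        ≈⟨ ⁻¹-∙-comm _ _ ⟨
      - (suc m · 1#) - (suc n · 1#)      ∎

    ⟦⟧-*-+ : ∀ m j → ⟦ + m ℤ.* j ⟧ ≈ ⟦ + m ⟧ * ⟦ j ⟧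
    ⟦⟧-*-+ m (+ n)    = begin
      ⟦ + m ℤ.* + n ⟧  ≡⟨ ≡.cong ⟦_⟧ (ℤₚ.pos-* m n) ⟨
      (m ℕ.* n) · 1#   ≈⟨ ×1-homo-* m n ⟩
      m · 1# * n · 1#  ∎
    ⟦⟧-*-+ m -[1+ n ] = begin
      ⟦ + m ℤ.* -[1+ n ] ⟧         ≡⟨ ≡.cong ⟦_⟧ (ℤₚ.neg-distribʳ-* (+ m) (+ suc n)) ⟨
      ⟦ ℤ.- (+ m ℤ.* + suc n) ⟧    ≈⟨ ⟦⟧-neg (+ m ℤ.* + suc n) ⟩
      - ⟦ + m ℤ.* + suc n ⟧        ≈⟨ R.-‿cong (⟦⟧-*-+ m (+ suc n)) ⟩
      - (m · 1# * suc n · 1#)      ≈⟨ -‿distribʳ-* _ _ ⟩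
      m · 1# * - (suc n · 1#)      ∎

    ⟦⟧-* : ∀ i j → ⟦ i ℤ.* j ⟧ ≈ ⟦ i ⟧ * ⟦ j ⟧
    ⟦⟧-* (+ m) j    = ⟦⟧-*-+ m j
    ⟦⟧-* -[1+ m ] j = begin
      ⟦ -[1+ m ] ℤ.* j ⟧         ≡⟨ ≡.cong ⟦_⟧ (ℤₚ.neg-distribˡ-* (+ suc m) j) ⟨
      ⟦ ℤ.- (+ suc m ℤ.* j) ⟧    ≈⟨ ⟦⟧-neg (+ suc m ℤ.* j) ⟩
      - ⟦ + suc m ℤ.* j ⟧        ≈⟨ R.-‿cong (⟦⟧-*-+ (suc m) j) ⟩
      - (suc m · 1# * ⟦ j ⟧)     ≈⟨ -‿distribˡ-* _ _ ⟩
      - (suc m · 1#) * ⟦ j ⟧     ∎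

    morphism : CommutativeRing.rawRing ℤₚ.+-*-commutativeRing -Raw-AlmostCommutative⟶ fromCommutativeRing R
    morphism = record
      { ⟦_⟧    = ⟦_⟧
      ; +-homo = ⟦⟧-+
      ; *-homo = ⟦⟧-*
      ; -‿homo = ⟦⟧-neg
      ; 0-homo = R.refl
      ; 1-homo = R.refl
      }

    ⟦⟧-≟ : ∀ i j → Maybe (⟦ i ⟧ ≈ ⟦ j ⟧)
    ⟦⟧-≟ i j = map (λ { ≡.refl → R.refl }) (dec⇒weaklyDec ℤₚ._≟_ i j)

  open RingSolver _ (fromCommutativeRing R) morphism ⟦⟧-≟ public
    using (Polynomial; solve; con; _:+_; _:*_; _:-_; :-_; _:=_)

  :0 :1 : ∀ {n} → Polynomial n
  :0 = con (+ 0)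
  :1 = con (+ 1)

-- The recurrence in s

module Recurrence {c ℓ} (K : CommutativeRing c ℓ) where

  private
    open module K = CommutativeRing K using (_≈_; _+_; _*_; _-_; 0#; 1#)
    open SemiringExp K.semiring using (_^_; ^-homo-*)
    open SemiringSum K.semiring using (sum)
    open IntegerSolver K
    open SetoidReasoning K.setoid

  1-cong : ∀ {u v} → u ≈ v → 1# - u ≈ 1# - v
  1-cong u≈v = K.+-congˡ (K.-‿cong u≈v)

  ∑< : ℕ → (ℕ → K.Carrier) → K.Carrier
  ∑< m f = sum {m} (λ i → f (toℕ i))

  ∑<-cong : ∀ m {f g : ℕ → K.Carrier} → (∀ i → f i ≈ g i) → ∑< m f ≈ ∑< m g
  ∑<-cong zero    f≈g = K.refl
  ∑<-cong (suc m) f≈g = K.+-cong (f≈g 0) (∑<-cong m λ i → f≈g (suc i))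

  ∑<-snoc : ∀ m (f : ℕ → K.Carrier) → ∑< (suc m) f ≈ ∑< m f + f m
  ∑<-snoc zero    f = K.trans (K.+-identityʳ _) (K.sym (K.+-identityˡ _))
  ∑<-snoc (suc m) f =
    K.trans (K.+-congˡ (∑<-snoc m λ i → f (suc i))) (K.sym (K.+-assoc _ _ _))

  -- X k = (x;Q)ₖ, Y k = (y;Q)ₖ and Z k = (Q;Q²)ₖ, while P k and R k are the
  -- reciprocals of (Q;Q)ₖ and (xyQ;Q²)ₖ. Only the ratios of consecutive terms
  -- enter the recurrence.
  record Factorials : Set (c ⊔ ℓ) where
    field
      Q x y     : K.Carrier
      X Y Z P R : ℕ → K.Carrier
      X-step : ∀ k → X (suc k) ≈ X k * (1# - x * Q ^ k)
      Y-step : ∀ k → Y (suc k) ≈ Y k * (1# - y * Q ^ k)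
      Z-step : ∀ k → Z (suc k) ≈ Z k * (1# - Q * (Q ^ k * Q ^ k))
      P-step : ∀ k → P k ≈ P (suc k) * (1# - Q * Q ^ k)
      R-step : ∀ k → R k ≈ R (suc k) * (1# - x * y * Q * (Q ^ k * Q ^ k))

  module _ (F : Factorials) where
    open Factorials F

    M : ℕ → K.Carrier
    M k = X k * Y k * Z k

    -- term s j is T(s,s+j), where T(s,k) is the k-th term of the sum at s.
    term : ℕ → ℕ → K.Carrier
    term s j = M (j ℕ.+ s) * Q ^ (j ℕ.+ s) * (P j * P (j ℕ.+ s ℕ.+ s) * R (j ℕ.+ s))

    -- With z = Q^s, `α` and `β` are the coefficients of the recurrence, and `γ` is the part of the
    -- certificate that does not depend on k.
    α β γ : ℕ → K.Carrier
    α s = (1# - Q ^ s * x) * (1# - Q ^ s * y)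
    β s = Q ^ s * Q ^ s * (x - Q ^ s * (Q * Q)) * (y - Q ^ s * (Q * Q))
    γ s = Q ^ s * (1# - Q ^ s * Q ^ s * (Q * Q))

    -- The certificate at k = s + j without its factors (x;Q)ₖ₊₁ (y;Q)ₖ₊₁. At k = n - 1 it is the
    -- C(s) of the recurrence.
    cofactor : ℕ → ℕ → K.Carrier
    cofactor s j = γ s * Z (suc (j ℕ.+ s)) * (P j * P (2 ℕ.+ (j ℕ.+ s ℕ.+ s)) * R (j ℕ.+ s))

    -- Gosper's algorithm applied to α T(s,k) - β T(s+2,k), with x and y free:
    -- this difference is certificate s j - certificate s (j - 1), where j = k - s.
    certificate : ℕ → ℕ → K.Carrier
    certificate s j = X (suc (j ℕ.+ s)) * Y (suc (j ℕ.+ s)) * cofactor s j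

    private
      -- `H` takes the larger index of each reciprocal (Q;Q)-factorial, so it can be taken out of
      -- T(s,k), T(s+2,k) and both certificates that meet at k = s + j. What is left of each is a
      -- polynomial in x, y and powers of Q.
      module Step (s j : ℕ) where
        z w k H : K.Carrier
        z = Q ^ s
        w = Q ^ j
        k = Q ^ (j ℕ.+ s)
        H = M (j ℕ.+ s) * (P j * P (2 ℕ.+ (j ℕ.+ s ℕ.+ s)) * R (j ℕ.+ s))

        k≈ : k ≈ z * w
        k≈ = K.trans (^-homo-* Q j s) (K.*-comm w z)

        kz≈ : Q ^ (j ℕ.+ s ℕ.+ s) ≈ z * k
        kz≈ = K.trans (^-homo-* Q (j ℕ.+ s) s) (K.*-comm k z)

        1-Q²zk : 1# - Q * Q ^ (suc (j ℕ.+ s ℕ.+ s)) ≈ 1# - Q * (Q * (z * k))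
        1-Q²zk = K.+-congˡ (K.-‿cong (K.*-congˡ (K.*-congˡ kz≈)))

        term≈ : term s j ≈ H * (k * ((1# - Q * (z * k)) * (1# - Q * (Q * (z * k)))))
        term≈ = begin
          M′ * k * (P j * P _ * R′)
            ≈⟨ K.*-congˡ (K.*-congʳ (K.*-congˡ (K.trans (P-step _) (K.*-cong
                 (K.trans (P-step _) (K.*-congˡ 1-Q²zk))
                 (K.+-congˡ (K.-‿cong (K.*-congˡ kz≈))))))) ⟩
          M′ * k * (P j * (P″ * u * v) * R′)
            ≈⟨ solve 7 (λ M k P P″ u v R → M :* k :* (P :* (P″ :* u :* v) :* R)
                 := M :* (P :* P″ :* R) :* (k :* (v :* u))) K.refl M′ k (P j) P″ u v R′ ⟩
          H * (k * (v * u)) ∎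
          where
          M′ = M (j ℕ.+ s)
          R′ = R (j ℕ.+ s)
          P″ = P (2 ℕ.+ (j ℕ.+ s ℕ.+ s))
          u = 1# - Q * (Q * (z * k))
          v = 1# - Q * (z * k)

        certificate≈ : certificate s j ≈
          γ s * (H * ((1# - x * k) * (1# - y * k) * (1# - Q * (k * k))))
        certificate≈ = begin
          X _ * Y _ * (γ s * Z _ * N)
            ≈⟨ K.*-cong (K.*-cong (X-step _) (Y-step _)) (K.*-congʳ (K.*-congˡ (Z-step _))) ⟩
          X′ * u * (Y′ * v) * (γ s * (Z′ * t) * N)
            ≈⟨ solve 8 (λ X Y Z u v t g N → X :* u :* (Y :* v) :* (g :* (Z :* t) :* N)
                 := g :* (X :* Y :* Z :* N :* (u :* v :* t))) K.refl X′ Y′ Z′ u v t (γ s) N ⟩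
          γ s * (H * (u * v * t)) ∎
          where
          N = P j * P (2 ℕ.+ (j ℕ.+ s ℕ.+ s)) * R (j ℕ.+ s)
          X′ = X (j ℕ.+ s)
          Y′ = Y (j ℕ.+ s)
          Z′ = Z (j ℕ.+ s)
          u = 1# - x * k
          v = 1# - y * k
          t = 1# - Q * (k * k)

      certificate-pred : ∀ s j → let open Step s (suc j) in certificate s j ≈
        γ s * (H * ((1# - Q * Q ^ j) * (1# - Q * (Q * (z * k)))
          * (1# - x * y * Q * (Q ^ (j ℕ.+ s) * Q ^ (j ℕ.+ s)))))
      certificate-pred s j = begin
        X′ * Y′ * (γ s * Z′ * (P j * P (2 ℕ.+ (j ℕ.+ s ℕ.+ s)) * R (j ℕ.+ s)))
          ≈⟨ K.*-congˡ (K.*-congˡ (K.*-cong (K.*-cong (P-step _)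
               (K.trans (P-step _) (K.*-congˡ 1-Q²zk))) (R-step _))) ⟩
        X′ * Y′ * (γ s * Z′ * (P′ * u * (P″ * v) * (R′ * t)))
          ≈⟨ solve 10 (λ X Y Z g P u P″ v R t →
               X :* Y :* (g :* Z :* (P :* u :* (P″ :* v) :* (R :* t)))
               := g :* (X :* Y :* Z :* (P :* P″ :* R) :* (u :* v :* t)))
               K.refl X′ Y′ Z′ (γ s) P′ u P″ v R′ t ⟩
        γ s * (H * (u * v * t)) ∎
        where
        open Step s (suc j)
        X′ = X (suc j ℕ.+ s)
        Y′ = Y (suc j ℕ.+ s)
        Z′ = Z (suc j ℕ.+ s)
        P′ = P (suc j)
        P″ = P (2 ℕ.+ (suc j ℕ.+ s ℕ.+ s))
        R′ = R (suc j ℕ.+ s)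
        u = 1# - Q * Q ^ j
        v = 1# - Q * (Q * (z * k))
        t = 1# - x * y * Q * (Q ^ (j ℕ.+ s) * Q ^ (j ℕ.+ s))

      -- term (2 + s) (j - 1), read as 0 for j = 0.
      shifted : ℕ → ℕ → K.Carrier
      shifted s j = let open Step s (suc j) in H * (k * ((1# - Q * Q ^ j) * (1# - Q ^ j)))

      -- The factor `1# - Q ^ j` vanishes at j = 0; it expresses the convention 1/(Q;Q)₋₁ = 0.
      shifted-zero : ∀ s → shifted s 0 ≈ 0#
      shifted-zero s = begin
        H * (k * ((1# - Q * 1#) * (1# - 1#))) ≈⟨ K.*-congˡ (K.*-congˡ (K.*-congˡ (K.-‿inverseʳ 1#))) ⟩
        H * (k * ((1# - Q * 1#) * 0#))        ≈⟨ K.*-congˡ (K.*-congˡ (K.zeroʳ _)) ⟩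
        H * (k * 0#)                          ≈⟨ K.*-congˡ (K.zeroʳ _) ⟩
        H * 0#                                ≈⟨ K.zeroʳ _ ⟩
        0#                                    ∎
        where open Step s 1

      shifted-suc : ∀ s j → shifted s (suc j) ≈ term (2 ℕ.+ s) j
      shifted-suc s j = K.sym (begin
        term (2 ℕ.+ s) j
          ≡⟨ ≡.cong₂ (λ m n → M m * Q ^ m * (P j * P n * R m)) m≡ n≡ ⟩
        M′ * k * (P j * P″ * R′)
          ≈⟨ K.*-congˡ (K.*-congʳ (K.*-congʳ (K.trans (P-step _) (K.*-congʳ (P-step _))))) ⟩
        M′ * k * (P (2 ℕ.+ j) * u * v * P″ * R′)
          ≈⟨ solve 7 (λ M k P u v P″ R → M :* k :* (P :* u :* v :* P″ :* R)
               := M :* (P :* P″ :* R) :* (k :* (u :* v))) K.refl M′ k (P (2 ℕ.+ j)) u v P″ R′ ⟩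
        H * (k * (u * v)) ∎)
        where
        open Step s (2 ℕ.+ j)
        m≡ : j ℕ.+ (2 ℕ.+ s) ≡ 2 ℕ.+ j ℕ.+ s
        m≡ = ≡.trans (ℕₚ.+-suc j (suc s)) (≡.cong suc (ℕₚ.+-suc j s))
        n≡ : j ℕ.+ (2 ℕ.+ s) ℕ.+ (2 ℕ.+ s) ≡ 2 ℕ.+ (2 ℕ.+ j ℕ.+ s ℕ.+ s)
        n≡ = ≡.trans (≡.cong (ℕ._+ (2 ℕ.+ s)) m≡)
          (≡.trans (ℕₚ.+-suc (2 ℕ.+ j ℕ.+ s) (suc s)) (≡.cong suc (ℕₚ.+-suc (2 ℕ.+ j ℕ.+ s) s)))
        M′ = M (2 ℕ.+ j ℕ.+ s)
        R′ = R (2 ℕ.+ j ℕ.+ s)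
        P″ = P (2 ℕ.+ (2 ℕ.+ j ℕ.+ s ℕ.+ s))
        u = 1# - Q * Q ^ suc j
        v = 1# - Q * Q ^ j

      -- The recurrence for single summands at index s + j + 1 after removal of `H`, with z = Q^s
      -- and w = Q^j made free variables. As x and y are free too, it is a plain polynomial
      -- identity.
      telescoping-identity : ∀ z Q w x y → let k = z * (Q * w) in
        (1# - z * x) * (1# - z * y) * (k * ((1# - Q * (z * k)) * (1# - Q * (Q * (z * k)))))
        ≈ z * z * (x - z * (Q * Q)) * (y - z * (Q * Q)) * (k * ((1# - Q * w) * (1# - w)))
        + z * (1# - z * z * (Q * Q))
          * ((1# - x * k) * (1# - y * k) * (1# - Q * (k * k))
             - (1# - Q * w) * (1# - Q * (Q * (z * k))) * (1# - x * y * Q * ((z * w) * (z * w))))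
      telescoping-identity = solve 5 (λ z Q w x y → let k = z :* (Q :* w) in
        (:1 :- z :* x) :* (:1 :- z :* y) :* (k :* ((:1 :- Q :* (z :* k)) :* (:1 :- Q :* (Q :* (z :* k)))))
        := z :* z :* (x :- z :* (Q :* Q)) :* (y :- z :* (Q :* Q)) :* (k :* ((:1 :- Q :* w) :* (:1 :- w)))
        :+ z :* (:1 :- z :* z :* (Q :* Q))
          :* ((:1 :- x :* k) :* (:1 :- y :* k) :* (:1 :- Q :* (k :* k))
             :- (:1 :- Q :* w) :* (:1 :- Q :* (Q :* (z :* k)))
                :* (:1 :- x :* y :* Q :* ((z :* w) :* (z :* w))))) K.refl

      -- At k = s both T(s+2,k) and the preceding certificate would contain 1/(Q;Q) at a negative
      -- index, so neither appears.
      step-zero : ∀ s → α s * term s 0 ≈ certificate s 0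
      step-zero s = begin
        α s * term s 0
          ≈⟨ K.*-congˡ term≈ ⟩
        α s * (H * (z * ((1# - Q * (z * z)) * (1# - Q * (Q * (z * z))))))
          ≈⟨ solve 5 (λ z Q x y H →
               (:1 :- z :* x) :* (:1 :- z :* y)
                 :* (H :* (z :* ((:1 :- Q :* (z :* z)) :* (:1 :- Q :* (Q :* (z :* z))))))
               := z :* (:1 :- z :* z :* (Q :* Q))
                 :* (H :* ((:1 :- x :* z) :* (:1 :- y :* z) :* (:1 :- Q :* (z :* z)))))
               K.refl z Q x y H ⟩
        γ s * (H * ((1# - x * z) * (1# - y * z) * (1# - Q * (z * z))))
          ≈⟨ certificate≈ ⟨
        certificate s 0 ∎
        where open Step s 0

      step-suc : ∀ s j →
        α s * term s (suc j) ≈ β s * shifted s j + (certificate s (suc j) - certificate s j)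
      step-suc s j = begin
        α s * term s (suc j)
          ≈⟨ K.*-congˡ term≈ ⟩
        α s * (H * e₁ k)
          ≈⟨ solve 3 (λ α H e → α :* (H :* e) := H :* (α :* e)) K.refl (α s) H (e₁ k) ⟩
        H * (α s * e₁ k)
          ≈⟨ K.*-congˡ (K.*-congˡ (e₁-cong k≈)) ⟩
        H * (α s * e₁ k′)
          ≈⟨ K.*-congˡ (telescoping-identity z Q w′ x y) ⟩
        H * (β s * e₂ k′ + γ s * (e₃ k′ - e₄ k′ (z * w′)))
          ≈⟨ K.*-congˡ (K.+-cong (K.*-congˡ (K.*-congʳ k≈))
               (K.*-congˡ (K.+-cong (e₃-cong k≈) (K.-‿cong (e₄-cong k≈ (Step.k≈ s j)))))) ⟨
        H * (β s * e₂ k + γ s * (e₃ k - e₄ k k⁻))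
          ≈⟨ solve 6 (λ H β γ a b c → H :* (β :* a :+ γ :* (b :- c))
               := β :* (H :* a) :+ (γ :* (H :* b) :- γ :* (H :* c)))
               K.refl H (β s) (γ s) (e₂ k) (e₃ k) (e₄ k k⁻) ⟩
        β s * (H * e₂ k) + (γ s * (H * e₃ k) - γ s * (H * e₄ k k⁻))
          ≈⟨ K.+-congˡ (K.+-cong certificate≈ (K.-‿cong (certificate-pred s j))) ⟨
        β s * shifted s j + (certificate s (suc j) - certificate s j) ∎
        where
        open Step s (suc j)
        w′ = Q ^ j
        k⁻ = Q ^ (j ℕ.+ s)
        k′ = z * (Q * w′)
        e₁ e₂ e₃ : K.Carrier → K.Carrier
        e₁ k = k * ((1# - Q * (z * k)) * (1# - Q * (Q * (z * k))))
        e₂ k = k * ((1# - Q * w′) * (1# - w′))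
        e₃ k = (1# - x * k) * (1# - y * k) * (1# - Q * (k * k))
        e₄ : K.Carrier → K.Carrier → K.Carrier
        e₄ k k⁻ = (1# - Q * w′) * (1# - Q * (Q * (z * k))) * (1# - x * y * Q * (k⁻ * k⁻))
        e₁-cong : ∀ {a b} → a ≈ b → e₁ a ≈ e₁ b
        e₁-cong e = K.*-cong e (K.*-cong (1-cong (K.*-congˡ (K.*-congˡ e)))
          (1-cong (K.*-congˡ (K.*-congˡ (K.*-congˡ e)))))
        e₃-cong : ∀ {a b} → a ≈ b → e₃ a ≈ e₃ b
        e₃-cong e = K.*-cong (K.*-cong (1-cong (K.*-congˡ e)) (1-cong (K.*-congˡ e)))
          (1-cong (K.*-congˡ (K.*-cong e e)))
        e₄-cong : ∀ {a b a′ b′} → a ≈ b → a′ ≈ b′ → e₄ a a′ ≈ e₄ b b′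
        e₄-cong e e′ = K.*-cong (K.*-congˡ (1-cong (K.*-congˡ (K.*-congˡ (K.*-congˡ e)))))
          (1-cong (K.*-congˡ (K.*-cong e′ e′)))

    ∑-term-1 : ∀ s → α s * ∑< 1 (term s) ≈ certificate s 0
    ∑-term-1 s = K.trans (K.*-congˡ (K.+-identityʳ _)) (step-zero s)

    -- Both sums end at k = s + m + 1, hence the one at s + 2 has two terms fewer. The certificate
    -- that survives has (x;Q) and (y;Q) at index s + m + 2, which is the n of the sum.
    ∑-term-2+ : ∀ m s →
      α s * ∑< (2 ℕ.+ m) (term s) ≈ β s * ∑< m (term (2 ℕ.+ s)) + certificate s (suc m)
    ∑-term-2+ m s = begin
      α s * ∑< (2 ℕ.+ m) (term s)
        ≈⟨ partial (suc m) ⟩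
      -- The first shifted term is T(s+2,s+1) = 0; without it the sum starts at k = s + 2.
      β s * Σ′ (suc m) + certificate s (suc m)
        ≈⟨ K.+-congʳ (K.*-congˡ (K.trans (K.+-congʳ (shifted-zero s)) (K.+-identityˡ _))) ⟩
      β s * ∑< m (λ i → shifted s (suc i)) + certificate s (suc m)
        ≈⟨ K.+-congʳ (K.*-congˡ (∑<-cong m (shifted-suc s))) ⟩
      β s * ∑< m (term (2 ℕ.+ s)) + certificate s (suc m) ∎
      where
      Σ′ : ℕ → K.Carrier
      Σ′ m = ∑< m (shifted s)
      partial : ∀ m → α s * ∑< (suc m) (term s) ≈ β s * Σ′ m + certificate s m
      partial zero = K.trans (∑-term-1 s)
        (K.sym (K.trans (K.+-congʳ (K.zeroʳ _)) (K.+-identityˡ _)))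
      partial (suc m) = begin
        α s * ∑< (2 ℕ.+ m) (term s)
          ≈⟨ K.*-congˡ (∑<-snoc (suc m) (term s)) ⟩
        α s * (∑< (suc m) (term s) + term s (suc m))
          ≈⟨ K.distribˡ _ _ _ ⟩
        α s * ∑< (suc m) (term s) + α s * term s (suc m)
          ≈⟨ K.+-cong (partial m) (step-suc s m) ⟩
        (β s * Σ′ m + certificate s m) + (β s * shifted s m + (certificate s (suc m) - certificate s m))
          ≈⟨ solve 5 (λ b a h c d → (b :* a :+ c) :+ (b :* h :+ (d :- c)) := b :* (a :+ h) :+ d)
               K.refl (β s) (Σ′ m) (shifted s m) (certificate s m) (certificate s (suc m)) ⟩
        β s * (Σ′ m + shifted s m) + certificate s (suc m)
          ≈⟨ K.+-congʳ (K.*-congˡ (∑<-snoc m (shifted s))) ⟨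
        β s * Σ′ (suc m) + certificate s (suc m) ∎

  inverse-unique : ∀ u v w → u * v ≈ 1# → u * w ≈ 1# → v ≈ w
  inverse-unique u v w uv≈1 uw≈1 = begin
    v           ≈⟨ K.*-identityʳ v ⟨
    v * 1#      ≈⟨ K.*-congˡ uw≈1 ⟨
    v * (u * w) ≈⟨ solve 3 (λ u v w → v :* (u :* w) := u :* v :* w) K.refl u v w ⟩
    u * v * w   ≈⟨ K.*-congʳ uv≈1 ⟩
    1# * w      ≈⟨ K.*-identityˡ w ⟩
    w           ∎

  -- Subrings, and divisibility of the sum by (x;Q)ₙ (y;Q)ₙ

  record Subring p : Set (c ⊔ ℓ ⊔ lsuc p) where
    field
      _∈      : K.Carrier → Set p
      ∈-resp  : ∀ {u v} → u ≈ v → u ∈ → v ∈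
      1-∈     : 1# ∈
      +-∈     : ∀ {u v} → u ∈ → v ∈ → (u + v) ∈
      *-∈     : ∀ {u v} → u ∈ → v ∈ → (u * v) ∈
      neg-∈   : ∀ {u} → u ∈ → (K.- u) ∈

    ^-∈ : ∀ {u} k → u ∈ → (u ^ k) ∈
    ^-∈ zero    u∈ = 1-∈
    ^-∈ (suc k) u∈ = *-∈ u∈ (^-∈ k u∈)

    1-_∈ : ∀ {u} → u ∈ → (1# - u) ∈
    1- u∈ ∈ = +-∈ 1-∈ (neg-∈ u∈)

    -- The condition is on the inverse: dividing by `u` must not leave the subring.
    Unit : K.Carrier → Set (c ⊔ ℓ ⊔ p)
    Unit u = ∃[ v ] v ∈ × u * v ≈ 1#

    Unit-* : ∀ {u v} → Unit u → Unit v → Unit (u * v)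
    Unit-* {u} {v} (u′ , u′∈ , uu′≈1) (v′ , v′∈ , vv′≈1) = u′ * v′ , *-∈ u′∈ v′∈ , (begin
      u * v * (u′ * v′)
        ≈⟨ solve 4 (λ u v u′ v′ → u :* v :* (u′ :* v′) := u :* u′ :* (v :* v′)) K.refl u v u′ v′ ⟩
      u * u′ * (v * v′) ≈⟨ K.*-cong uu′≈1 vv′≈1 ⟩
      1# * 1#           ≈⟨ K.*-identityˡ 1# ⟩
      1#                ∎)

    Unit-resp : ∀ {u v} → u ≈ v → Unit u → Unit v
    Unit-resp u≈v (u′ , u′∈ , uu′≈1) = u′ , u′∈ , K.trans (K.*-congʳ (K.sym u≈v)) uu′≈1

    -- The reciprocals of u(0) ⋯ u(k-1), multiplied up from the inverses supplied by `unit`, so that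
    -- membership in the subring is immediate.
    reciprocals : {u : ℕ → K.Carrier} → (∀ k → Unit (u k)) → ℕ → K.Carrier
    reciprocals unit zero    = 1#
    reciprocals unit (suc k) = reciprocals unit k * proj₁ (unit k)

    module _ {u : ℕ → K.Carrier} (unit : ∀ k → Unit (u k)) where

      reciprocals-∈ : ∀ k → reciprocals unit k ∈
      reciprocals-∈ zero    = 1-∈
      reciprocals-∈ (suc k) = *-∈ (reciprocals-∈ k) (proj₁ (proj₂ (unit k)))

      reciprocals-step : ∀ k → reciprocals unit k ≈ reciprocals unit (suc k) * u k
      reciprocals-step k = K.sym (begin
        reciprocals unit k * v * u k   ≈⟨ K.*-assoc _ _ _ ⟩
        reciprocals unit k * (v * u k) ≈⟨ K.*-congˡ (K.trans (K.*-comm v (u k)) (proj₂ (proj₂ (unit k)))) ⟩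
        reciprocals unit k * 1#        ≈⟨ K.*-identityʳ _ ⟩
        reciprocals unit k             ∎)
        where v = proj₁ (unit k)

      reciprocals-inverse : (A : ℕ → K.Carrier) → A 0 ≈ 1# → (∀ k → A (suc k) ≈ A k * u k) →
        ∀ k → A k * reciprocals unit k ≈ 1#
      reciprocals-inverse A A0 A-step zero    = K.trans (K.*-identityʳ _) A0
      reciprocals-inverse A A0 A-step (suc k) = begin
        A (suc k) * r′            ≈⟨ K.*-congʳ (A-step k) ⟩
        A k * u k * r′            ≈⟨ K.*-assoc _ _ _ ⟩
        A k * (u k * r′)          ≈⟨ K.*-congˡ (K.trans (K.*-comm _ _) (K.sym (reciprocals-step k))) ⟩
        A k * reciprocals unit k  ≈⟨ reciprocals-inverse A A0 A-step k ⟩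
        1#                        ∎
        where r′ = reciprocals unit (suc k)

  -- These are the ingredients of the quotient of the sum by (x;Q)ₙ (y;Q)ₙ, that is, of `β` and
  -- `cofactor`.
  record IsIntegral {p} (O : Subring p) (F : Factorials) : Set (c ⊔ p) where
    open Subring O
    open Factorials F
    field
      Q-∈ : Q ∈
      x-∈ : x ∈
      y-∈ : y ∈
      Z-∈ : ∀ k → Z k ∈
      P-∈ : ∀ k → P k ∈
      R-∈ : ∀ k → R k ∈

  module _ {p} (O : Subring p) {F : Factorials} (integral : IsIntegral O F) where
    open Subring O
    open Factorials F
    open IsIntegral integral

    private
      Q^-∈ : ∀ s → (Q ^ s) ∈
      Q^-∈ s = ^-∈ s Q-∈

      β-∈ : ∀ s → β F s ∈
      β-∈ s = *-∈ (*-∈ (*-∈ (Q^-∈ s) (Q^-∈ s)) (factor-∈ x-∈)) (factor-∈ y-∈)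
        where
        factor-∈ : ∀ {u} → u ∈ → (u - Q ^ s * (Q * Q)) ∈
        factor-∈ u∈ = +-∈ u∈ (neg-∈ (*-∈ (Q^-∈ s) (*-∈ Q-∈ Q-∈)))

      cofactor-∈ : ∀ s j → cofactor F s j ∈
      cofactor-∈ s j = *-∈ (*-∈
        (*-∈ (Q^-∈ s) (1- *-∈ (*-∈ (Q^-∈ s) (Q^-∈ s)) (*-∈ Q-∈ Q-∈) ∈))
        (Z-∈ _)) (*-∈ (*-∈ (P-∈ _) (P-∈ _)) (R-∈ _))

      divide : ∀ {A S W V} → Unit A → A * S ≈ W * V → V ∈ → ∃[ V′ ] V′ ∈ × S ≈ W * V′
      divide {A} {S} {W} {V} (A′ , A′∈ , AA′≈1) AS≈WV V∈ = A′ * V , *-∈ A′∈ V∈ , (begin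
        S             ≈⟨ K.*-identityˡ S ⟨
        1# * S        ≈⟨ K.*-congʳ AA′≈1 ⟨
        A * A′ * S    ≈⟨ solve 3 (λ A A′ S → A :* A′ :* S := A′ :* (A :* S)) K.refl A A′ S ⟩
        A′ * (A * S)  ≈⟨ K.*-congˡ AS≈WV ⟩
        A′ * (W * V)  ≈⟨ solve 3 (λ A′ W V → A′ :* (W :* V) := W :* (A′ :* V)) K.refl A′ W V ⟩
        W * (A′ * V)  ∎)

    -- The recurrence is solved from large s downwards: passing from s + 2 to s adds two terms and
    -- keeps n = m + s, so the same product X(n) Y(n) factors out at every stage, and each stage
    -- divides by one value of `α`. The starting points are the empty sum and the sum of one term.
    ∑-term-divisible : ∀ m s → (∀ i → Unit (α F (2 ℕ.* i ℕ.+ s))) →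
      ∃[ V ] V ∈ × ∑< m (term F s) ≈ X (m ℕ.+ s) * Y (m ℕ.+ s) * V
    ∑-term-divisible zero    s unit =
      -- The quotient for the empty sum is 0, obtained in the subring as -1 + 1.
      K.- 1# + 1# , +-∈ (neg-∈ 1-∈) 1-∈ ,
      K.sym (K.trans (K.*-congˡ (K.-‿inverseˡ 1#)) (K.zeroʳ _))
    ∑-term-divisible (suc zero) s unit = divide (unit 0) (∑-term-1 F s) (cofactor-∈ s 0)
    ∑-term-divisible (suc (suc m)) s unit = extend (∑-term-divisible m (2 ℕ.+ s) unit′)
      where
      unit′ : ∀ i → Unit (α F (2 ℕ.* i ℕ.+ (2 ℕ.+ s)))
      unit′ i = ≡.subst (λ j → Unit (α F j)) (index i) (unit (suc i))
        where
        index : ∀ i → 2 ℕ.* suc i ℕ.+ s ≡ 2 ℕ.* i ℕ.+ (2 ℕ.+ s)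
        index i = ≡.trans (≡.cong (ℕ._+ s) (≡.trans (ℕₚ.*-suc 2 i) (ℕₚ.+-comm 2 (2 ℕ.* i))))
          (ℕₚ.+-assoc (2 ℕ.* i) 2 s)
      W = X (2 ℕ.+ m ℕ.+ s) * Y (2 ℕ.+ m ℕ.+ s)
      index : m ℕ.+ (2 ℕ.+ s) ≡ 2 ℕ.+ m ℕ.+ s
      index = ≡.trans (ℕₚ.+-suc m (suc s)) (≡.cong suc (ℕₚ.+-suc m s))
      extend : ∃[ V ] V ∈ × ∑< m (term F (2 ℕ.+ s)) ≈ X (m ℕ.+ (2 ℕ.+ s)) * Y (m ℕ.+ (2 ℕ.+ s)) * V →
        ∃[ V ] V ∈ × ∑< (2 ℕ.+ m) (term F s) ≈ W * V
      extend (V , V∈ , S≈) = divide (unit 0) (begin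
        α F s * ∑< (2 ℕ.+ m) (term F s)
          ≈⟨ ∑-term-2+ F m s ⟩
        β F s * ∑< m (term F (2 ℕ.+ s)) + W * cofactor F s (suc m)
          ≈⟨ K.+-congʳ (K.*-congˡ S≈) ⟩
        β F s * (X (m ℕ.+ (2 ℕ.+ s)) * Y (m ℕ.+ (2 ℕ.+ s)) * V) + W * cofactor F s (suc m)
          ≡⟨ ≡.cong (λ k → β F s * (X k * Y k * V) + W * cofactor F s (suc m)) index ⟩
        β F s * (W * V) + W * cofactor F s (suc m)
          ≈⟨ solve 4 (λ b W V c → b :* (W :* V) :+ W :* c := W :* (b :* V :+ c))
               K.refl (β F s) W V (cofactor F s (suc m)) ⟩
        W * (β F s * V + cofactor F s (suc m)) ∎)
        (+-∈ (*-∈ (β-∈ s) V∈) (cofactor-∈ s (suc m)))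

-- The sum of the theorem as an instance of the recurrence

module BasicSum {c ℓ p} (K : CommutativeRing c ℓ) (O : Recurrence.Subring K p) where

  private
    open module K = CommutativeRing K using (_≈_; _+_; _*_; _-_; 0#; 1#)
    open SemiringExp K.semiring using (_^_; ^-homo-*; ^-assocʳ)
    open IntegerSolver K
    open SetoidReasoning K.setoid
    open Recurrence K
    open Recurrence.Subring O

  -- e plays the part of q^(d-r).
  record Setting : Set (c ⊔ ℓ ⊔ p) where
    field
      _⁻¹        : K.Carrier → K.Carrier
      ⁻¹-unique  : ∀ {u v} → u * v ≈ 1# → u ⁻¹ ≈ v
      poch       : K.Carrier → K.Carrier → ℕ → K.Carrier
      poch-zero  : ∀ u v → poch u v 0 ≈ 1#
      poch-suc   : ∀ u v k → poch u v (suc k) ≈ poch u v k * (1# - u * v ^ k)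
      d r t t′   : ℕ
      q a b e    : K.Carrier
      e*q^r      : e * q ^ r ≈ q ^ d
      q-∈        : q ∈
      a-∈        : a ∈
      b-∈        : b ∈
      e-∈        : e ∈
      1-q^-unit  : ∀ k → Unit (1# - q ^ d * (q ^ d) ^ k)
      1-ab-unit  : ∀ i → Unit (1# - a * b * q ^ i)
      1-a-unit   : ∀ {s} → s ≢ t → Unit (1# - a * q ^ (r ℕ.+ d ℕ.* s))
      1-b-unit   : ∀ {s} → s ≢ t′ → Unit (1# - b * (e * q ^ (d ℕ.* s)))

  module _ (setting : Setting) where
    open Setting setting

    private
      Q x y q²ᵈ : K.Carrier
      Q   = q ^ d
      x   = a * q ^ r
      y   = b * e
      q²ᵈ = q ^ (2 ℕ.* d)

      q²ᵈ^ : ∀ k → q²ᵈ ^ k ≈ Q ^ k * Q ^ k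
      q²ᵈ^ k = begin
        q²ᵈ ^ k                     ≈⟨ ^-assocʳ q (2 ℕ.* d) k ⟩
        q ^ (2 ℕ.* d ℕ.* k)         ≡⟨ ≡.cong (q ^_) (≡.trans (ℕₚ.*-assoc 2 d k)
                                         (≡.cong (d ℕ.* k ℕ.+_) (ℕₚ.+-identityʳ (d ℕ.* k)))) ⟩
        q ^ (d ℕ.* k ℕ.+ d ℕ.* k)   ≈⟨ ^-homo-* q (d ℕ.* k) (d ℕ.* k) ⟩
        q ^ (d ℕ.* k) * q ^ (d ℕ.* k) ≈⟨ K.*-cong (^-assocʳ q d k) (^-assocʳ q d k) ⟨
        Q ^ k * Q ^ k               ∎

      -- The exponents r and d - r add up to d, so xy = abQ. This matches the denominator
      -- (abq^(2d);q^(2d))ₖ with (xyQ;Q²)ₖ.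
      xyQ≈ : x * y * Q ≈ a * b * q²ᵈ
      xyQ≈ = begin
        a * q ^ r * (b * e) * Q
          ≈⟨ solve 5 (λ a b e q Q → a :* q :* (b :* e) :* Q := a :* b :* (e :* q :* Q)) K.refl a b e (q ^ r) Q ⟩
        a * b * (e * q ^ r * Q)
          ≈⟨ K.*-congˡ (K.*-congʳ e*q^r) ⟩
        a * b * (Q * Q)
          ≈⟨ K.*-congˡ (^-homo-* q d d) ⟨
        a * b * q ^ (d ℕ.+ d)
          ≡⟨ ≡.cong (λ i → a * b * q ^ (d ℕ.+ i)) (ℕₚ.+-identityʳ d) ⟨
        a * b * q²ᵈ ∎

      1-abq²ᵈ-unit : ∀ k → Unit (1# - a * b * q²ᵈ * q²ᵈ ^ k)
      1-abq²ᵈ-unit k = Unit-resp (1-cong (begin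
        a * b * q ^ (2 ℕ.* d ℕ.+ 2 ℕ.* d ℕ.* k)  ≈⟨ K.*-congˡ (^-homo-* q (2 ℕ.* d) (2 ℕ.* d ℕ.* k)) ⟩
        a * b * (q²ᵈ * q ^ (2 ℕ.* d ℕ.* k))      ≈⟨ K.*-congˡ (K.*-congˡ (^-assocʳ q (2 ℕ.* d) k)) ⟨
        a * b * (q²ᵈ * q²ᵈ ^ k)                  ≈⟨ K.*-assoc _ _ _ ⟨
        a * b * q²ᵈ * q²ᵈ ^ k                    ∎)) (1-ab-unit (2 ℕ.* d ℕ.+ 2 ℕ.* d ℕ.* k))

      x*Q^ : ∀ s → x * Q ^ s ≈ a * q ^ (r ℕ.+ d ℕ.* s)
      x*Q^ s = begin
        a * q ^ r * Q ^ s              ≈⟨ K.*-assoc _ _ _ ⟩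
        a * (q ^ r * Q ^ s)            ≈⟨ K.*-congˡ (K.*-congˡ (^-assocʳ q d s)) ⟩
        a * (q ^ r * q ^ (d ℕ.* s))    ≈⟨ K.*-congˡ (^-homo-* q r (d ℕ.* s)) ⟨
        a * q ^ (r ℕ.+ d ℕ.* s)        ∎

      y*Q^ : ∀ s → y * Q ^ s ≈ b * (e * q ^ (d ℕ.* s))
      y*Q^ s = K.trans (K.*-assoc _ _ _) (K.*-congˡ (K.*-congˡ (^-assocʳ q d s)))

      F : Factorials
      F = record
        { Q = Q
        ; x = x
        ; y = y
        ; X = poch x Q
        ; Y = poch y Q
        ; Z = poch Q q²ᵈ
        ; P = reciprocals 1-q^-unit
        ; R = reciprocals 1-abq²ᵈ-unit
        ; X-step = poch-suc x Q
        ; Y-step = poch-suc y Q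
        ; Z-step = λ k → K.trans (poch-suc Q q²ᵈ k) (K.*-congˡ (1-cong (K.*-congˡ (q²ᵈ^ k))))
        ; P-step = reciprocals-step 1-q^-unit
        ; R-step = λ k → K.trans (reciprocals-step 1-abq²ᵈ-unit k)
            (K.*-congˡ (1-cong (K.*-cong (K.sym xyQ≈) (q²ᵈ^ k))))
        }

      poch-∈ : ∀ {u v} → u ∈ → v ∈ → ∀ k → poch u v k ∈
      poch-∈ {u} {v} u∈ v∈ zero    = ∈-resp (K.sym (poch-zero u v)) 1-∈
      poch-∈ {u} {v} u∈ v∈ (suc k) =
        ∈-resp (K.sym (poch-suc u v k)) (*-∈ (poch-∈ u∈ v∈ k) 1- *-∈ u∈ (^-∈ k v∈) ∈)

      F-integral : IsIntegral O F
      F-integral = record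
        { Q-∈ = ^-∈ d q-∈
        ; x-∈ = *-∈ a-∈ (^-∈ r q-∈)
        ; y-∈ = *-∈ b-∈ e-∈
        ; Z-∈ = poch-∈ (^-∈ d q-∈) (^-∈ (2 ℕ.* d) q-∈)
        ; P-∈ = reciprocals-∈ 1-q^-unit
        ; R-∈ = reciprocals-∈ 1-abq²ᵈ-unit
        }

      poch-factor : ∀ {u v k n} → u ∈ → v ∈ → k < n → ∃[ V ] V ∈ × poch u v n ≈ (1# - u * v ^ k) * V
      poch-factor {u} {v} {k} {suc n} u∈ v∈ k<1+n with ℕₚ.m≤n⇒m<n∨m≡n (ℕₚ.≤-pred k<1+n)
      ... | inj₂ ≡.refl = poch u v n , poch-∈ u∈ v∈ n , K.trans (poch-suc u v n) (K.*-comm _ _)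
      ... | inj₁ k<n    =
        let V , V∈ , eq = poch-factor u∈ v∈ k<n in
        V * (1# - u * v ^ n) , *-∈ V∈ 1- *-∈ u∈ (^-∈ n v∈) ∈ ,
        K.trans (poch-suc u v n) (K.trans (K.*-congʳ eq) (K.*-assoc _ _ _))

    summand : ℕ → ℕ → K.Carrier
    summand s k =
      (poch (a * q ^ r) (q ^ d) k * poch (b * e) (q ^ d) k * poch (q ^ d) (q ^ (2 ℕ.* d)) k * q ^ (d ℕ.* k))
      * (poch (q ^ d) (q ^ d) (k ∸ s) * poch (q ^ d) (q ^ d) (k ℕ.+ s)
         * poch (a * b * q ^ (2 ℕ.* d)) (q ^ (2 ℕ.* d)) k) ⁻¹

    private
      -- The inverse in `summand` is an operation known only through `⁻¹-unique`; it is evaluated by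
      -- exhibiting the product of `P`, `P` and `R` as an inverse of the denominator.
      summand≈term : ∀ s j → summand s (s ℕ.+ j) ≈ term F s j
      summand≈term s j = begin
        summand s (s ℕ.+ j)
          ≡⟨ ≡.cong₂ (λ k i → N k * (D i * D (k ℕ.+ s) * E k) ⁻¹) (ℕₚ.+-comm s j) (ℕₚ.m+n∸m≡n s j) ⟩
        N (j ℕ.+ s) * (D j * D (j ℕ.+ s ℕ.+ s) * E (j ℕ.+ s)) ⁻¹
          ≈⟨ K.*-cong (K.*-congˡ (K.sym (^-assocʳ q d (j ℕ.+ s)))) (⁻¹-unique (begin
               D j * D (j ℕ.+ s ℕ.+ s) * E (j ℕ.+ s) * (P j * P (j ℕ.+ s ℕ.+ s) * R (j ℕ.+ s))
                 ≈⟨ solve 6 (λ A B C A′ B′ C′ → A :* B :* C :* (A′ :* B′ :* C′)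
                      := A :* A′ :* (B :* B′) :* (C :* C′)) K.refl
                      (D j) (D (j ℕ.+ s ℕ.+ s)) (E (j ℕ.+ s)) (P j) (P (j ℕ.+ s ℕ.+ s)) (R (j ℕ.+ s)) ⟩
               D j * P j * (D (j ℕ.+ s ℕ.+ s) * P (j ℕ.+ s ℕ.+ s)) * (E (j ℕ.+ s) * R (j ℕ.+ s))
                 ≈⟨ K.*-cong (K.*-cong (D-inverse j) (D-inverse (j ℕ.+ s ℕ.+ s))) (E-inverse (j ℕ.+ s)) ⟩
               1# * 1# * 1#
                 ≈⟨ K.trans (K.*-identityʳ _) (K.*-identityʳ _) ⟩
               1# ∎)) ⟩
        term F s j ∎
        where
        open Factorials F using (P; R)
        D E N : ℕ → K.Carrier
        D = poch Q Q
        E = poch (a * b * q²ᵈ) q²ᵈ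
        N k = poch x Q k * poch y Q k * poch Q q²ᵈ k * q ^ (d ℕ.* k)
        D-inverse : ∀ k → D k * P k ≈ 1#
        D-inverse = reciprocals-inverse 1-q^-unit D (poch-zero Q Q) (poch-suc Q Q)
        E-inverse : ∀ k → E k * R k ≈ 1#
        E-inverse = reciprocals-inverse 1-abq²ᵈ-unit E
          (poch-zero (a * b * q²ᵈ) q²ᵈ) (poch-suc (a * b * q²ᵈ) q²ᵈ)

    -- Since t and t′ are below n, 1 - xQ^t is a factor of (x;Q)ₙ and 1 - yQ^t′ one of (y;Q)ₙ. The
    -- last two hypotheses keep these two factors out of the values of `α` at s, s + 2, ..., by
    -- which the recurrence divides.
    ∑-divisible : ∀ n s → s ≤ n → t < n → t′ < n →
      (∀ i → 2 ℕ.* i ℕ.+ s ≢ t) → (∀ i → 2 ℕ.* i ℕ.+ s ≢ t′) →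
      ∃[ V ] V ∈ × ∑< (n ∸ s) (λ j → summand s (s ℕ.+ j))
        ≈ (1# - a * q ^ (r ℕ.+ d ℕ.* t)) * (1# - b * (e * q ^ (d ℕ.* t′))) * V
    ∑-divisible n s s≤n t<n t′<n s≢t s≢t′ =
      let V , V∈ , sum≈ = ∑-term-divisible O F-integral (n ∸ s) s α-unit
          V₁ , V₁∈ , X≈ = poch-factor {x} {Q} (IsIntegral.x-∈ F-integral) (^-∈ d q-∈) t<n
          V₂ , V₂∈ , Y≈ = poch-factor {y} {Q} (IsIntegral.y-∈ F-integral) (^-∈ d q-∈) t′<n
      in V₁ * V₂ * V , *-∈ (*-∈ V₁∈ V₂∈) V∈ , (begin
        ∑< (n ∸ s) (λ j → summand s (s ℕ.+ j))
          ≈⟨ ∑<-cong (n ∸ s) (summand≈term s) ⟩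
        ∑< (n ∸ s) (term F s)
          ≈⟨ sum≈ ⟩
        poch x Q (n ∸ s ℕ.+ s) * poch y Q (n ∸ s ℕ.+ s) * V
          ≡⟨ ≡.cong (λ k → poch x Q k * poch y Q k * V) (ℕₚ.m∸n+n≡m s≤n) ⟩
        poch x Q n * poch y Q n * V
          ≈⟨ K.*-congʳ (K.*-cong X≈ Y≈) ⟩
        (1# - x * Q ^ t) * V₁ * ((1# - y * Q ^ t′) * V₂) * V
          ≈⟨ solve 5 (λ u v V₁ V₂ V → u :* V₁ :* (v :* V₂) :* V := u :* v :* (V₁ :* V₂ :* V))
               K.refl (1# - x * Q ^ t) (1# - y * Q ^ t′) V₁ V₂ V ⟩
        (1# - x * Q ^ t) * (1# - y * Q ^ t′) * (V₁ * V₂ * V)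
          ≈⟨ K.*-congʳ (K.*-cong (1-cong (x*Q^ t)) (1-cong (y*Q^ t′))) ⟩
        (1# - a * q ^ (r ℕ.+ d ℕ.* t)) * (1# - b * (e * q ^ (d ℕ.* t′))) * (V₁ * V₂ * V) ∎)
      where
      α-unit : ∀ i → Unit (α F (2 ℕ.* i ℕ.+ s))
      α-unit i = Unit-*
        (Unit-resp (1-cong (K.trans (K.sym (x*Q^ _)) (K.*-comm x _))) (1-a-unit (s≢t i)))
        (Unit-resp (1-cong (K.trans (K.sym (y*Q^ _)) (K.*-comm y _))) (1-b-unit (s≢t′ i)))

-- Primes in polynomial rings

module Divisibility {c ℓ} (D : IntegralDomain c ℓ) where

  private
    open module D = IntegralDomain D using (_≈_; _≉_; _+_; _*_; -_; _-_; 0#; 1#)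
    open IntegerSolver D.commutativeRing
    open SetoidReasoning D.setoid

  open RawSemiringDefinitions (Semiring.rawSemiring D.semiring) public
    using (_∣_; _∤_; Prime; Coprime)
  open RawSemiringDefinitions.Prime public
  open RawMagmaDefinitions._∣ʳ_ public
  open RawMagmaDefinitions (Semiring.*-rawMagma D.semiring) public using (_,_)

  ∣-resp : ∀ {p x y} → x ≈ y → p ∣ x → p ∣ y
  ∣-resp x≈y (u , e) = u , D.trans e x≈y

  ∣-+ : ∀ {p x y} → p ∣ x → p ∣ y → p ∣ x + y
  ∣-+ (u , e) (v , f) = u + v , D.trans (D.distribʳ _ u v) (D.+-cong e f)

  ∣-* : ∀ {p x} y → p ∣ x → p ∣ y * x
  ∣-* y (u , e) = y * u , D.trans (D.*-assoc y u _) (D.*-congˡ e)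

  ∣-*ʳ : ∀ {p x} y → p ∣ x → p ∣ x * y
  ∣-*ʳ y p∣x = ∣-resp (D.*-comm y _) (∣-* y p∣x)

  ∣-neg : ∀ {p x} → p ∣ x → p ∣ - x
  ∣-neg {x = x} p∣x =
    ∣-resp (solve 1 (λ x → :- :1 :* x := :- x) D.refl x) (∣-* (- 1#) p∣x)

  ∣-trans : ∀ {p x y} → p ∣ x → x ∣ y → p ∣ y
  ∣-trans p∣x (u , e) = ∣-resp e (∣-* u p∣x)

  ∣0 : ∀ {p x} → x ≈ 0# → p ∣ x
  ∣0 x≈0 = 0# , D.trans (D.zeroˡ _) (D.sym x≈0)

  ∣-refl : ∀ {p} → p ∣ p
  ∣-refl = 1# , D.*-identityˡ _

  module _ {p p′} (p-prime : Prime p) (p′-prime : Prime p′) where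

    private
      cancel : ∀ {p w z e} → Prime p → w * p * z ≈ p * e → w * z ≈ e
      cancel {p} {w} {z} {e} p-prime wpz≈pe = FractionField.*-cancelʳ D p (p≉0 p-prime) (begin
        w * z * p ≈⟨ solve 3 (λ w z p → w :* z :* p := w :* p :* z) D.refl w z p ⟩
        w * p * z ≈⟨ wpz≈pe ⟩
        p * e     ≈⟨ D.*-comm p e ⟩
        e * p     ∎)

      divisor : ∀ {p w z e} → Prime p → p ∤ z → w * z ≈ p * e → ∃[ w′ ] w′ * z ≈ e
      divisor {p} {w} {z} {e} p-prime p∤z wz≈pe with split-∣ p-prime (e , D.trans (D.*-comm e p) (D.sym wz≈pe))
      ... | inj₁ (w′ , w′p≈w) = w′ , cancel p-prime (D.trans (D.*-congʳ w′p≈w) wz≈pe)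
      ... | inj₂ p∣z          = contradiction p∣z p∤z

    -- Every common divisor z has to be a unit. From w z = p p′ and p ∤ z, primality puts p into w,
    -- where it cancels; the same with p′ leaves w₂ z = 1.
    coprime-*ʳ : ∀ {u} → p ∤ u → p′ ∤ u → Coprime u (p * p′)
    coprime-*ʳ p∤u p′∤u z∣u (w , wz≈pp′) =
      let w₁ , e₁ = divisor p-prime (λ p∣z → p∤u (∣-trans p∣z z∣u)) wz≈pp′
          w₂ , e₂ = divisor p′-prime (λ p′∣z → p′∤u (∣-trans p′∣z z∣u))
                      (D.trans e₁ (D.sym (D.*-identityʳ _)))
      in w₂ , e₂

-- R/(p) is R itself with a coarser equality, so that polynomials over R/(p)
-- are the same lists as polynomials over R.
module Quotient {c ℓ} (D : IntegralDomain c ℓ)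
  (p : IntegralDomain.Carrier D)
  (p-prime : Divisibility.Prime D p)
  (p∣? : Decidable₁ (Divisibility._∣_ D p)) where

  private
    open module D = IntegralDomain D using (_≈_; _≉_; _+_; _*_; -_; _-_; 0#; 1#)
    open Divisibility D
    open IntegerSolver D.commutativeRing

  infix 4 _≋_
  _≋_ : D.Carrier → D.Carrier → Set _
  x ≋ y = p ∣ x - y

  ≈⇒≋ : ∀ {x y} → x ≈ y → x ≋ y
  ≈⇒≋ {x} {y} x≈y = ∣0 (D.trans (D.+-congʳ x≈y) (D.-‿inverseʳ y))

  ≋0⇒∣ : ∀ {x} → x ≋ 0# → p ∣ x
  ≋0⇒∣ {x} = ∣-resp (solve 1 (λ x → x :- :0 := x) D.refl x)

  ∣⇒≋0 : ∀ {x} → p ∣ x → x ≋ 0#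
  ∣⇒≋0 {x} = ∣-resp (solve 1 (λ x → x := x :- :0) D.refl x)

  quotientRing : CommutativeRing c _
  quotientRing = record
    { Carrier = D.Carrier
    ; _≈_ = _≋_
    ; _+_ = _+_
    ; _*_ = _*_
    ; -_  = -_
    ; 0#  = 0#
    ; 1#  = 1#
    ; isCommutativeRing = record
      { isRing = record
        { +-isAbelianGroup = record
          { isGroup = record
            { isMonoid = record
              { isSemigroup = record
                { isMagma = record
                  { isEquivalence = record
                    { refl  = ≈⇒≋ D.refl
                    ; sym   = λ {x} {y} e → ∣-resp
                        (solve 2 (λ x y → :- (x :- y) := y :- x) D.refl x y) (∣-neg e)
                    ; trans = λ {x} {y} {z} e f → ∣-resp
                        (solve 3 (λ x y z → (x :- y) :+ (y :- z) := x :- z) D.refl x y z) (∣-+ e f)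
                    }
                  ; ∙-cong = λ {x} {y} {u} {v} e f → ∣-resp
                      (solve 4 (λ x y u v → (x :- y) :+ (u :- v) := (x :+ u) :- (y :+ v))
                        D.refl x y u v) (∣-+ e f)
                  }
                ; assoc = λ x y z → ≈⇒≋ (D.+-assoc x y z)
                }
              ; identity = (λ x → ≈⇒≋ (D.+-identityˡ x)) , (λ x → ≈⇒≋ (D.+-identityʳ x))
              }
            ; inverse = (λ x → ≈⇒≋ (D.-‿inverseˡ x)) , (λ x → ≈⇒≋ (D.-‿inverseʳ x))
            ; ⁻¹-cong = λ {x} {y} e → ∣-resp
                (solve 2 (λ x y → :- (x :- y) := :- x :- :- y) D.refl x y) (∣-neg e)
            }
          ; comm = λ x y → ≈⇒≋ (D.+-comm x y)
          }
        ; *-cong = λ {x} {y} {u} {v} e f → ∣-resp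
            (solve 4 (λ x y u v → u :* (x :- y) :+ y :* (u :- v) := x :* u :- y :* v)
              D.refl x y u v) (∣-+ (∣-* u e) (∣-* y f))
        ; *-assoc    = λ x y z → ≈⇒≋ (D.*-assoc x y z)
        ; *-identity = (λ x → ≈⇒≋ (D.*-identityˡ x)) , (λ x → ≈⇒≋ (D.*-identityʳ x))
        ; distrib    = (λ x y z → ≈⇒≋ (D.distribˡ x y z)) , (λ x y z → ≈⇒≋ (D.distribʳ x y z))
        }
      ; *-comm = λ x y → ≈⇒≋ (D.*-comm x y)
      }
    }

  quotientDomain : IntegralDomain c _
  quotientDomain = record
    { commutativeRing = quotientRing
    ; _≟_             = λ x y → p∣? (x - y)
    ; 1≉0             = λ e → p∤1 p-prime (≋0⇒∣ e)
    ; noZeroDivisors  = λ x y e → ⊎-map ∣⇒≋0 ∣⇒≋0 (split-∣ p-prime (≋0⇒∣ e))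
    }

module ConstantPrime {c ℓ} (D : IntegralDomain c ℓ)
  (p : IntegralDomain.Carrier D)
  (p-prime : Divisibility.Prime D p)
  (p∣? : Decidable₁ (Divisibility._∣_ D p)) where

  private
    open module D = IntegralDomain D using (_≈_; _+_; _*_; 0#; 1#)
    open PolynomialDomain D
    module P = IntegralDomain polyDomain
    module ∣₀ = Divisibility D
    module ∣ₚ = Divisibility polyDomain
    open ∣₀ using (_∣_; _,_)
    open ∣ₚ using () renaming (_∣_ to _∣ₚ_)
    open Quotient D p p-prime p∣?
    module Q = PolynomialDomain quotientDomain

    -- The operations on polynomials never consult the equality of coefficients, so over the
    -- quotient they return the same lists.
    coeff-≡ : ∀ f i → Q.coeff f i ≡ coeff f i
    coeff-≡ []      i       = ≡.refl
    coeff-≡ (c ∷ f) zero    = ≡.refl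
    coeff-≡ (c ∷ f) (suc i) = coeff-≡ f i

    +ₚ-≡ : ∀ f g → f Q.+ₚ g ≡ f +ₚ g
    +ₚ-≡ []      g       = ≡.refl
    +ₚ-≡ (c ∷ f) []      = ≡.refl
    +ₚ-≡ (c ∷ f) (e ∷ g) = ≡.cong (c + e ∷_) (+ₚ-≡ f g)

    *ₚ-≡ : ∀ f g → f Q.*ₚ g ≡ f *ₚ g
    *ₚ-≡ []      g = ≡.refl
    *ₚ-≡ (c ∷ f) g = ≡.trans (+ₚ-≡ (c ·ₚ g) (0# ∷ f Q.*ₚ g))
      (≡.cong (λ h → c ·ₚ g +ₚ (0# ∷ h)) (*ₚ-≡ f g))

    coeff-*const : ∀ f i → coeff (f *ₚ const p) i ≈ coeff f i * p
    coeff-*const f i = D.trans (at (*ₚ-comm f (const p)) i) (D.trans (coeff-+ (p ·ₚ f) (0# ∷ []) i)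
      (D.trans (D.+-cong (coeff-· p f i) (zeros i)) (D.trans (D.+-identityʳ _) (D.*-comm p _))))
      where
      zeros : ∀ i → coeff (0# ∷ []) i ≈ 0#
      zeros zero    = D.refl
      zeros (suc i) = D.refl

  const∣⇒∣coeff : ∀ {f} → const p ∣ₚ f → ∀ i → p ∣ coeff f i
  const∣⇒∣coeff (h ∣ₚ., e) i = coeff h i , D.trans (D.sym (coeff-*const h i)) (at e i)

  ∣coeff⇒const∣ : ∀ f → (∀ i → p ∣ coeff f i) → const p ∣ₚ f
  ∣coeff⇒const∣ f p∣f = quotients f p∣f ∣ₚ., coeffs λ i →
    D.trans (coeff-*const (quotients f p∣f) i) (coeff-quotients f p∣f i)
    where
    quotients : ∀ f → (∀ i → p ∣ coeff f i) → Poly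
    quotients []      p∣f = []
    quotients (c ∷ f) p∣f = ∣₀.quotient (p∣f 0) ∷ quotients f (λ i → p∣f (suc i))
    coeff-quotients : ∀ f p∣f i → coeff (quotients f p∣f) i * p ≈ coeff f i
    coeff-quotients []      p∣f i       = D.zeroˡ p
    coeff-quotients (c ∷ f) p∣f zero    = ∣₀.equality (p∣f 0)
    coeff-quotients (c ∷ f) p∣f (suc i) = coeff-quotients f (λ i → p∣f (suc i)) i

  private
    const∣⇒≈0 : ∀ {f} → const p ∣ₚ f → f Q.≈ₚ Q.0ₚ
    const∣⇒≈0 {f} e = Q.coeffs λ i →
      ≡.subst (_≋ 0#) (≡.sym (coeff-≡ f i)) (∣⇒≋0 (const∣⇒∣coeff e i))

    ≈0⇒const∣ : ∀ f → f Q.≈ₚ Q.0ₚ → const p ∣ₚ f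
    ≈0⇒const∣ f e = ∣coeff⇒const∣ f λ i → ≋0⇒∣ (≡.subst (_≋ 0#) (coeff-≡ f i) (Q.at e i))

  -- Reduction of coefficients identifies D[X]/(p) with (D/p)[X], which is a domain because D/p is
  -- one.
  const-prime : ∣ₚ.Prime (const p)
  const-prime = record
    { p≉0     = λ e → ∣₀.p≉0 p-prime (at e 0)
    ; p∤1     = λ e → ∣₀.p∤1 p-prime (const∣⇒∣coeff e 0)
    ; split-∣ = λ {f} {g} e → ⊎-map (≈0⇒const∣ f) (≈0⇒const∣ g)
        (Q.*ₚ-noZeroDivisors f g (≡.subst (Q._≈ₚ Q.0ₚ) (≡.sym (*ₚ-≡ f g)) (const∣⇒≈0 e)))
    }

module PolynomialLemmas {c ℓ} (D : IntegralDomain c ℓ) where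

  private
    open module D = IntegralDomain D using (_≈_; _≉_; _+_; _*_; -_; _-_; 0#; 1#)
    open PolynomialDomain D
    module P = IntegralDomain polyDomain
    open SemiringExp D.semiring using (_^_)
    open SemiringExp P.semiring using () renaming (_^_ to _^ₚ_)

  const-cong : ∀ {c e} → c ≈ e → const c ≈ₚ const e
  const-cong c≈e = ∷-cong c≈e P.refl

  const-* : ∀ c e → const (c * e) ≈ₚ const c *ₚ const e
  const-* c e = ∷-cong (D.sym (D.+-identityʳ _)) P.refl

  const-^ : ∀ c k → const (c ^ k) ≈ₚ const c ^ₚ k
  const-^ c zero    = P.refl
  const-^ c (suc k) = P.trans (const-* c (c ^ k)) (P.*-congˡ {const c} (const-^ c k))

  X* : ∀ f → X *ₚ f ≈ₚ 0# ∷ f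
  X* f = P.trans (shift-*ₚ (1# ∷ []) f D.refl) (∷-cong D.refl (*ₚ-identityˡ f))

  ∷≈const+X* : ∀ c f → c ∷ f ≈ₚ const c +ₚ X *ₚ f
  ∷≈const+X* c f = P.trans (∷-cong (D.sym (D.+-identityʳ c)) P.refl)
    (P.+-congˡ {const c} (P.sym (X* f)))

  -- Compares constant terms. That distinct powers of q are distinct is all that the study of the
  -- moduli assumes about q.
  X^-injective : ∀ i j → X ^ₚ i ≈ₚ X ^ₚ j → i ≡ j
  X^-injective zero    zero    e = ≡.refl
  X^-injective zero    (suc j) e = contradiction (D.trans (at e 0) (at (X* (X ^ₚ j)) 0)) D.1≉0
  X^-injective (suc i) zero    e = contradiction (D.trans (D.sym (at e 0)) (at (X* (X ^ₚ i)) 0)) D.1≉0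
  X^-injective (suc i) (suc j) e = ≡.cong suc (X^-injective i j
    (tail-cong (P.trans (P.sym (X* (X ^ₚ i))) (P.trans e (X* (X ^ₚ j))))))

module LinearPrime {c ℓ} (D : IntegralDomain c ℓ) (α β : IntegralDomain.Carrier D) where

  private
    open module D = IntegralDomain D using (_≈_; _≉_; _+_; _*_; -_; _-_; 0#; 1#)
    open PolynomialDomain D
    open PolynomialLemmas D
    module P = IntegralDomain polyDomain
    open SemiringExp P.semiring using (_^_)
    open Divisibility polyDomain
    open IntegerSolver polyRing
    open SetoidReasoning P.setoid

  linear : Poly
  linear = const α P.- const β *ₚ X

  private
    p b : Poly
    p = linear
    b = const β

  -- Pseudo-division by α - βX: the remainder is f(α/β) with its denominator cleared by a power of
  -- β.
  record Reduct (f : Poly) : Set (c ⊔ ℓ) where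
    constructor reduct
    field
      power     : ℕ
      remainder : D.Carrier
      quot      : Poly
      equation  : b ^ power *ₚ f ≈ₚ const remainder +ₚ p *ₚ quot
  open Reduct

  reduce : ∀ f → Reduct f
  reduce []      = reduct 0 0# 0ₚ (P.trans (P.zeroʳ (b ^ 0))
    (P.sym (P.trans (P.+-cong (∷-zero D.refl P.refl) (P.zeroʳ p)) (P.+-identityˡ 0ₚ))))
  reduce (e ∷ f) =
    let reduct k c h eq = reduce f in
    -- A Horner step. In βX (c + p h) the product βX c equals α c - p c, which gives both the new
    -- remainder and the term - c of the quotient.
    reduct (suc k) (β^ (suc k) * e + α * c) (b *ₚ X *ₚ h P.- const c) (begin
      b *ₚ b ^ k *ₚ (e ∷ f)
        ≈⟨ P.*-congˡ {b *ₚ b ^ k} (∷≈const+X* e f) ⟩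
      b *ₚ b ^ k *ₚ (const e +ₚ X *ₚ f)
        ≈⟨ solve 5 (λ b bk e X f → b :* bk :* (e :+ X :* f) := b :* bk :* e :+ b :* X :* (bk :* f))
             P.refl b (b ^ k) (const e) X f ⟩
      b *ₚ b ^ k *ₚ const e +ₚ b *ₚ X *ₚ (b ^ k *ₚ f)
        ≈⟨ P.+-congˡ {b *ₚ b ^ k *ₚ const e} (P.*-congˡ {b *ₚ X} eq) ⟩
      b *ₚ b ^ k *ₚ const e +ₚ b *ₚ X *ₚ (const c +ₚ p *ₚ h)
        ≈⟨ solve 6 (λ e X b a c h → e :+ b :* X :* (c :+ (a :- b :* X) :* h)
             := e :+ a :* c :+ (a :- b :* X) :* (b :* X :* h :- c))
             P.refl (b *ₚ b ^ k *ₚ const e) X b (const α) (const c) h ⟩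
      b *ₚ b ^ k *ₚ const e +ₚ const α *ₚ const c +ₚ p *ₚ (b *ₚ X *ₚ h P.- const c)
        ≈⟨ P.+-congʳ {p *ₚ (b *ₚ X *ₚ h P.- const c)} (P.+-cong
             (P.trans (const-* (β^ (suc k)) e) (P.*-congʳ {const e} (const-^ β (suc k))))
             (const-* α c)) ⟨
      const (β^ (suc k) * e + α * c) +ₚ p *ₚ (b *ₚ X *ₚ h P.- const c) ∎)
    where
    β^ : ℕ → D.Carrier
    β^ k = β D^ k
      where open SemiringExp D.semiring renaming (_^_ to _D^_)

  module _ (β≉0 : β ≉ 0#) where

    private
      -- The hypothesis says that (α - βX) h is constant. Coefficients past the end of the list are
      -- 0, and β ≉ 0 carries this down to the first one.
      geometric⇒0 : ∀ h → (∀ i → β * coeff h i ≈ α * coeff h (suc i)) → h ≈ₚ 0ₚ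
      geometric⇒0 []      eq = P.refl
      geometric⇒0 (c ∷ h) eq = ∷-zero c≈0 h≈0
        where
        h≈0 = geometric⇒0 h (λ i → eq (suc i))
        c≈0 : c ≈ 0#
        c≈0 = [ (λ β≈0 → contradiction β≈0 β≉0) , (λ c≈0 → c≈0) ]′ (D.noZeroDivisors β c
          (D.trans (eq 0) (D.trans (D.*-congˡ (at h≈0 0)) (D.zeroʳ α))))

      linear≈ : linear ≈ₚ α ∷ - β ∷ []
      linear≈ = P.trans (P.+-congˡ {const α} (P.-‿cong (P.trans (*ₚ-comm b X) (X* b))))
        (∷-cong (D.trans (D.+-congˡ -0#≈0#) (D.+-identityʳ α)) P.refl)
        where open RingProperties D.ring using (-0#≈0#)

      coeff-linear* : ∀ h i → coeff (linear *ₚ h) (suc i) ≈ α * coeff h (suc i) - β * coeff h i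
      coeff-linear* h i =
        D.trans (at (*ₚ-congʳ h linear≈) (suc i))
          (D.trans (coeff-+ (α ·ₚ h) (0# ∷ (- β) ·ₚ h +ₚ (0# ∷ [])) (suc i))
            (D.+-cong (coeff-· α h (suc i))
              (D.trans (coeff-+ ((- β) ·ₚ h) (0# ∷ []) i)
                (D.trans (D.+-cong (coeff-· (- β) h i) (zeros i))
                  (D.trans (D.+-identityʳ _) (D.sym (-‿distribˡ-* β (coeff h i))))))))
        where
        open RingProperties D.ring using (-‿distribˡ-*)
        zeros : ∀ i → coeff (0# ∷ []) i ≈ 0#
        zeros zero    = D.refl
        zeros (suc i) = D.refl

    linear∣const⇒0 : ∀ {c} → linear ∣ const c → c ≈ 0#
    linear∣const⇒0 {c} (h , hp≈c) = D.trans (D.sym (at hp≈c 0)) (at (*ₚ-zeroˡ h p h≈0) 0)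
      where
      h≈0 : h ≈ₚ 0ₚ
      h≈0 = geometric⇒0 h λ i → D.sym (x∙y⁻¹≈ε⇒x≈y _ _ (D.trans (D.sym (coeff-linear* h i))
        (D.trans (at (*ₚ-comm linear h) (suc i)) (at hp≈c (suc i)))))
        where open RingProperties D.ring using (x∙y⁻¹≈ε⇒x≈y)

    -- The multiplier g is arbitrary, so this also serves to refute divisibility: it suffices to
    -- exhibit one multiple of f with a non-zero remainder.
    ∣⇒remainder≈0 : ∀ {f} g c h → g *ₚ f ≈ₚ const c +ₚ linear *ₚ h → linear ∣ f → c ≈ 0#
    ∣⇒remainder≈0 {f} g c h eq p∣f = linear∣const⇒0 (∣-resp (begin
      g *ₚ f P.- p *ₚ h                ≈⟨ P.+-congʳ {P.- (p *ₚ h)} eq ⟩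
      const c +ₚ p *ₚ h P.- p *ₚ h     ≈⟨ solve 2 (λ c h → c :+ h :- h := c) P.refl (const c) (p *ₚ h) ⟩
      const c                          ∎)
      (∣-+ (∣-* g p∣f) (∣-neg (∣-*ʳ h ∣-refl))))

    module _ u w (b-unit : b *ₚ u ≈ₚ 1ₚ +ₚ linear *ₚ w) where

      private
        -- By `b-unit`, u is an inverse of β modulo p, which undoes the powers of β that
        -- pseudo-division introduces. The condition excludes a common factor of α and β.
        cancel : ∀ k f → p ∣ b ^ k *ₚ f → p ∣ f
        cancel zero    f p∣f  = ∣-resp (*ₚ-identityˡ f) p∣f
        cancel (suc k) f p∣bf = cancel k f (∣-resp (begin
          u *ₚ (b *ₚ b ^ k *ₚ f) P.- p *ₚ (w *ₚ (b ^ k *ₚ f))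
            ≈⟨ solve 6 (λ u b bk f p w → u :* (b :* bk :* f) :- p :* (w :* (bk :* f))
                 := (b :* u :- p :* w) :* (bk :* f)) P.refl u b (b ^ k) f p w ⟩
          (b *ₚ u P.- p *ₚ w) *ₚ (b ^ k *ₚ f)
            ≈⟨ P.*-congʳ {b ^ k *ₚ f} (P.+-congʳ {P.- (p *ₚ w)} b-unit) ⟩
          (1ₚ +ₚ p *ₚ w P.- p *ₚ w) *ₚ (b ^ k *ₚ f)
            ≈⟨ solve 2 (λ pw g → (:1 :+ pw :- pw) :* g := g) P.refl (p *ₚ w) (b ^ k *ₚ f) ⟩
          b ^ k *ₚ f ∎)
          (∣-+ (∣-* u p∣bf) (∣-neg (∣-*ʳ (w *ₚ (b ^ k *ₚ f)) ∣-refl))))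

        remainder≈0⇒∣ : ∀ {f} (r : Reduct f) → remainder r ≈ 0# → p ∣ f
        remainder≈0⇒∣ {f} (reduct k c h eq) c≈0 = cancel k f (∣-resp (begin
          p *ₚ h            ≈⟨ P.+-congʳ {p *ₚ h} (∷-zero c≈0 P.refl) ⟨
          const c +ₚ p *ₚ h ≈⟨ eq ⟨
          b ^ k *ₚ f        ∎) (∣-*ʳ h ∣-refl))

        product-remainder : ∀ {f g} (r : Reduct f) (r′ : Reduct g) → p ∣ f *ₚ g →
          remainder r * remainder r′ ≈ 0#
        product-remainder {f} {g} (reduct k c h eq) (reduct l e h′ eq′) =
          ∣⇒remainder≈0 (b ^ k *ₚ b ^ l) (c * e) t (begin
            b ^ k *ₚ b ^ l *ₚ (f *ₚ g)
              ≈⟨ solve 4 (λ bk bl f g → bk :* bl :* (f :* g) := bk :* f :* (bl :* g))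
                   P.refl (b ^ k) (b ^ l) f g ⟩
            b ^ k *ₚ f *ₚ (b ^ l *ₚ g)
              ≈⟨ P.*-cong eq eq′ ⟩
            (const c +ₚ p *ₚ h) *ₚ (const e +ₚ p *ₚ h′)
              ≈⟨ solve 5 (λ c e p h h′ → (c :+ p :* h) :* (e :+ p :* h′)
                   := c :* e :+ p :* (h :* e :+ c :* h′ :+ h :* (p :* h′)))
                   P.refl (const c) (const e) p h h′ ⟩
            const c *ₚ const e +ₚ p *ₚ t
              ≈⟨ P.+-congʳ {p *ₚ t} (const-* c e) ⟨
            const (c * e) +ₚ p *ₚ t ∎)
          where t = h *ₚ const e +ₚ const c *ₚ h′ +ₚ h *ₚ (p *ₚ h′)

      -- Decides whether the remainder vanishes. This provides the decidable equality of the
      -- quotient domain modulo a prime in `a`.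
      linear∣? : Decidable₁ (linear ∣_)
      linear∣? f = map′ (remainder≈0⇒∣ r)
        (∣⇒remainder≈0 (b ^ power r) (remainder r) (quot r) (equation r)) (remainder r D.≟ 0#)
        where r = reduce f

      -- Remainders multiply, being values at α/β up to powers of β, and the ring of coefficients
      -- has no zero divisors.
      linear-prime : Prime linear
      linear-prime = record
        { p≉0     = λ p≈0 → β≉0 (D.trans (D.sym (-‿involutive β))
            (D.trans (D.-‿cong (D.trans (D.sym (at linear≈ 1)) (at p≈0 1))) -0#≈0#))
        ; p∤1     = λ p∣1 → D.1≉0 (linear∣const⇒0 p∣1)
        ; split-∣ = λ {f} {g} p∣fg → ⊎-map (remainder≈0⇒∣ (reduce f)) (remainder≈0⇒∣ (reduce g))
            (D.noZeroDivisors (remainder (reduce f)) (remainder (reduce g))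
              (product-remainder (reduce f) (reduce g) p∣fg))
        }
        where open RingProperties D.ring using (-0#≈0#; -‿involutive)

-- The two moduli as primes of D₀[a,b]

module Moduli {c ℓ} (D₀ : IntegralDomain c ℓ) (q₀ : IntegralDomain.Carrier D₀)
  (q₀^-injective : ∀ i j → IntegralDomain._≈_ D₀
     (SemiringExp._^_ (IntegralDomain.semiring D₀) q₀ i)
     (SemiringExp._^_ (IntegralDomain.semiring D₀) q₀ j) → i ≡ j) where

  private
    module D₀ = IntegralDomain D₀
    module A  = PolynomialDomain D₀
    module D₁ = IntegralDomain A.polyDomain
    module B  = PolynomialDomain A.polyDomain
    module D₂ = IntegralDomain B.polyDomain
    module A′ = PolynomialLemmas D₀
    module B′ = PolynomialLemmas A.polyDomain
    open SemiringExp D₀.semiring using () renaming (_^_ to _^₀_)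
    open SemiringExp D₁.semiring using () renaming (_^_ to _^₁_; ^-homo-* to ^₁-homo-*)
    open SemiringExp D₂.semiring using (_^_)
    module ∣₁ = Divisibility A.polyDomain
    open Divisibility B.polyDomain
    module S₁ = IntegerSolver D₁.commutativeRing
    module S₂ = IntegerSolver D₂.commutativeRing

    q₁ : D₁.Carrier
    q₁ = A.const q₀

  q₂ a₂ b₂ : D₂.Carrier
  q₂ = B.const q₁
  a₂ = B.const A.X
  b₂ = B.X

  private
    q₀^≉0 : ∀ i → q₀ ^₀ i D₀.≉ D₀.0#
    q₀^≉0 i e = ℕₚ.1+n≢n (q₀^-injective (suc i) i
      (D₀.trans (D₀.*-congˡ e) (D₀.trans (D₀.zeroʳ q₀) (D₀.sym e))))

    q₁^≈ : ∀ i → q₁ ^₁ i D₁.≈ A.const (q₀ ^₀ i)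
    q₁^≈ i = D₁.sym (A′.const-^ q₀ i)

    q₂^≈ : ∀ i → q₂ ^ i D₂.≈ B.const (q₁ ^₁ i)
    q₂^≈ i = D₂.sym (B′.const-^ q₁ i)

    const-≉0 : ∀ {x} → x D₀.≉ D₀.0# → A.const x D₁.≉ D₁.0#
    const-≉0 x≉0 e = x≉0 (A.at e 0)

    q₁^≉0 : ∀ i → q₁ ^₁ i D₁.≉ D₁.0#
    q₁^≉0 i e = q₀^≉0 i (A.at (D₁.trans (D₁.sym (q₁^≈ i)) e) 0)

    -≉0 : ∀ {x y} → ¬ x D₀.≈ y → x D₀.- y D₀.≉ D₀.0#
    -≉0 x≉y e = x≉y (RingProperties.x∙y⁻¹≈ε⇒x≈y D₀.ring _ _ e)

    1-q₀^≉0 : ∀ i → D₀.1# D₀.- q₀ ^₀ suc i D₀.≉ D₀.0#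
    1-q₀^≉0 i = -≉0 λ e → case₀ (q₀^-injective 0 (suc i) e)
      where
      case₀ : ¬ 0 ≡ suc i
      case₀ ()

    -X*≉0 : ∀ {g h} → A.coeff g 0 D₀.≉ D₀.0# → g D₁.- A.X D₁.* h D₁.≉ D₁.0#
    -X*≉0 {g} {h} g₀≉0 e = g₀≉0 (D₀.trans (A.at (RingProperties.x∙y⁻¹≈ε⇒x≈y D₁.ring g (A.X D₁.* h) e) 0)
      (A.at (A′.X* h) 0))

    1-q₂^≈ : ∀ i → D₂.1# D₂.- q₂ ^ i D₂.≈ B.const (A.const (D₀.1# D₀.- q₀ ^₀ i))
    1-q₂^≈ i = D₂.+-congˡ {D₂.1#} (D₂.-‿cong
      (D₂.trans (q₂^≈ i) (B′.const-cong (q₁^≈ i))))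

  module _ (u : ℕ) where
    private
      module L = LinearPrime D₀ D₀.1# (q₀ ^₀ u)
      p₁ = L.linear
      β≉0 = q₀^≉0 u

      -- Modulo 1 - q^u a, the variable a itself is the inverse of q^u.
      unit : A.const (q₀ ^₀ u) D₁.* A.X D₁.≈ D₁.1# D₁.+ p₁ D₁.* (D₁.- D₁.1#)
      unit = solve 1 (λ t → t := :1 :+ (:1 :- t) :* (:- :1)) D₁.refl (A.const (q₀ ^₀ u) D₁.* A.X)
        where open S₁

      p₁-prime = L.linear-prime β≉0 A.X (D₁.- D₁.1#) unit
      module C = ConstantPrime A.polyDomain p₁ p₁-prime (L.linear∣? β≉0 A.X (D₁.- D₁.1#) unit)

    P₁ : D₂.Carrier
    P₁ = B.const p₁

    -- Two stages: 1 - a q^u is a linear prime of D₀[a], and it stays prime as a constant of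
    -- D₀[a][b].
    P₁-prime : Prime P₁
    P₁-prime = C.const-prime

    P₁≈ : P₁ D₂.≈ D₂.1# D₂.- a₂ D₂.* q₂ ^ u
    P₁≈ = D₂.sym (D₂.+-congˡ {D₂.1#} (D₂.-‿cong (begin
      a₂ D₂.* q₂ ^ u                        ≈⟨ D₂.*-congˡ {a₂} (D₂.trans (q₂^≈ u) (B′.const-cong (q₁^≈ u))) ⟩
      a₂ D₂.* B.const (A.const (q₀ ^₀ u))   ≈⟨ B′.const-* A.X (A.const (q₀ ^₀ u)) ⟨
      B.const (A.X D₁.* A.const (q₀ ^₀ u))  ≈⟨ B′.const-cong (D₁.*-comm A.X (A.const (q₀ ^₀ u))) ⟩
      B.const (A.const (q₀ ^₀ u) D₁.* A.X)  ∎)))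
      where open SetoidReasoning D₂.setoid

    private
      P₁∤const : ∀ {f} g → f D₂.≈ B.const g → p₁ ∣₁.∤ g → P₁ ∤ f
      P₁∤const g f≈g p₁∤g P₁∣f = p₁∤g (C.const∣⇒∣coeff (∣-resp f≈g P₁∣f) 0)

      -- A constant divides coefficientwise, so the coefficient g at b⁰ already decides.
      P₁∤const+X* : ∀ {f} g h → f D₂.≈ B.const g D₂.+ B.X D₂.* h → p₁ ∣₁.∤ g → P₁ ∤ f
      P₁∤const+X* g h f≈ p₁∤g P₁∣f =
        p₁∤g (C.const∣⇒∣coeff (∣-resp (D₂.trans f≈ (D₂.sym (B′.∷≈const+X* g h))) P₁∣f) 0)

      p₁∤const : ∀ {x} → x D₀.≉ D₀.0# → p₁ ∣₁.∤ A.const x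
      p₁∤const x≉0 p₁∣x = x≉0 (L.linear∣const⇒0 β≉0 p₁∣x)

    P₁∤q^ : ∀ i → P₁ ∤ q₂ ^ i
    P₁∤q^ i = P₁∤const (A.const (q₀ ^₀ i))
      (D₂.trans (q₂^≈ i) (B′.const-cong (q₁^≈ i))) (p₁∤const (q₀^≉0 i))

    P₁∤1-q^ : ∀ i → P₁ ∤ D₂.1# D₂.- q₂ ^ suc i
    P₁∤1-q^ i = P₁∤const _ (1-q₂^≈ (suc i)) (p₁∤const (1-q₀^≉0 i))

    -- Substituting a = q^(-u) and clearing q^u leaves the remainder q^u - q^v.
    P₁∤1-aq^ : ∀ v → u ≢ v → P₁ ∤ D₂.1# D₂.- a₂ D₂.* q₂ ^ v
    P₁∤1-aq^ v u≢v = P₁∤const (D₁.1# D₁.- A.X D₁.* q₁ ^₁ v)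
      (D₂.+-congˡ {D₂.1#} (D₂.-‿cong (D₂.trans (D₂.*-congˡ {a₂} (q₂^≈ v))
        (D₂.sym (B′.const-* A.X (q₁ ^₁ v))))))
      λ p₁∣ → -≉0 (λ e → u≢v (q₀^-injective u v e))
        (L.∣⇒remainder≈0 β≉0 (A.const (q₀ ^₀ u)) (q₀ ^₀ u D₀.- q₀ ^₀ v) (A.const (q₀ ^₀ v)) (begin
          U D₁.* (D₁.1# D₁.- A.X D₁.* q₁ ^₁ v)
            ≈⟨ D₁.*-congˡ {U} (D₁.+-congˡ {D₁.1#} (D₁.-‿cong (D₁.*-congˡ {A.X} (q₁^≈ v)))) ⟩
          U D₁.* (D₁.1# D₁.- A.X D₁.* V)
            ≈⟨ solve 3 (λ U V X → U :* (:1 :- X :* V) := U :- V :+ (:1 :- U :* X) :* V) D₁.refl U V A.X ⟩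
          U D₁.- V D₁.+ p₁ D₁.* V ∎) p₁∣)
      where
      open S₁
      open SetoidReasoning D₁.setoid
      U = A.const (q₀ ^₀ u)
      V = A.const (q₀ ^₀ v)

    P₁∤1-abq^ : ∀ i → P₁ ∤ D₂.1# D₂.- a₂ D₂.* b₂ D₂.* q₂ ^ i
    P₁∤1-abq^ i = P₁∤const+X* D₁.1# (D₂.- (a₂ D₂.* q₂ ^ i))
      (solve 3 (λ a b q → :1 :- a :* b :* q := :1 :+ b :* (:- (a :* q))) D₂.refl a₂ b₂ (q₂ ^ i))
      (p₁∤const D₀.1≉0)
      where open S₂

    P₁∤q^-bq^ : ∀ i j → P₁ ∤ q₂ ^ i D₂.- b₂ D₂.* q₂ ^ j
    P₁∤q^-bq^ i j = P₁∤const+X* (A.const (q₀ ^₀ i)) (D₂.- (q₂ ^ j))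
      (D₂.trans
        (solve 3 (λ a b q → a :- b :* q := a :+ b :* (:- q)) D₂.refl (q₂ ^ i) b₂ (q₂ ^ j))
        (D₂.+-congʳ {b₂ D₂.* D₂.- (q₂ ^ j)} (D₂.trans (q₂^≈ i) (B′.const-cong (q₁^≈ i)))))
      (p₁∤const (q₀^≉0 i))
      where open S₂

  module _ (m m′ : ℕ) (mm′ : m ≡ 0 ⊎ m′ ≡ 0) where
    private
      module L = LinearPrime A.polyDomain (q₁ ^₁ m) (q₁ ^₁ m′)
      β≉0 = q₁^≉0 m′
      β = B.const (q₁ ^₁ m′)

    -- The numerator q^m - b q^m′ of 1 - b q^(m′-m). By `mm′` the two terms share no power of q, as
    -- primality requires.
    P₂ : D₂.Carrier
    P₂ = L.linear

    P₂≈ : P₂ D₂.≈ q₂ ^ m D₂.- b₂ D₂.* q₂ ^ m′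
    P₂≈ = D₂.sym (D₂.+-cong (q₂^≈ m) (D₂.-‿cong
      (D₂.trans (D₂.*-congˡ {b₂} (q₂^≈ m′)) (D₂.*-comm b₂ β))))

    P₂-prime : Prime P₂
    P₂-prime = prime mm′
      where
      open S₂
      prime : m ≡ 0 ⊎ m′ ≡ 0 → Prime P₂
      -- For 1 - b q^m′ the inverse of q^m′ is b.
      prime (inj₁ ≡.refl) = L.linear-prime β≉0 B.X (D₂.- D₂.1#)
        (solve 1 (λ t → t := :1 :+ (:1 :- t) :* (:- :1)) D₂.refl (β D₂.* B.X))
      -- For q^m - b the coefficient β is 1, its own inverse.
      prime (inj₂ ≡.refl) = L.linear-prime β≉0 D₂.1# D₂.0#
        (solve 1 (λ t → :1 :* :1 := :1 :+ t :* :0) D₂.refl P₂)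

    private
      P₂∤const : ∀ {f} g → f D₂.≈ B.const g → g D₁.≉ D₁.0# → P₂ ∤ f
      P₂∤const g f≈g g≉0 P₂∣f = g≉0 (L.linear∣const⇒0 β≉0 (∣-resp f≈g P₂∣f))

    P₂∤q^ : ∀ i → P₂ ∤ q₂ ^ i
    P₂∤q^ i = P₂∤const (q₁ ^₁ i) (q₂^≈ i) (q₁^≉0 i)

    P₂∤1-q^ : ∀ i → P₂ ∤ D₂.1# D₂.- q₂ ^ suc i
    P₂∤1-q^ i = P₂∤const _ (1-q₂^≈ (suc i)) (const-≉0 (1-q₀^≉0 i))

    P₂∤1-aq^ : ∀ v → P₂ ∤ D₂.1# D₂.- a₂ D₂.* q₂ ^ v
    P₂∤1-aq^ v = P₂∤const (D₁.1# D₁.- A.X D₁.* q₁ ^₁ v)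
      (D₂.+-congˡ {D₂.1#} (D₂.-‿cong (D₂.trans (D₂.*-congˡ {a₂} (q₂^≈ v))
        (D₂.sym (B′.const-* A.X (q₁ ^₁ v))))))
      (-X*≉0 {D₁.1#} {q₁ ^₁ v} D₀.1≉0)

    -- Substituting b = q^(m-m′) and clearing q^m′ leaves q^m′ - a q^(i+m), which is non-zero
    -- already at a = 0.
    P₂∤1-abq^ : ∀ i → P₂ ∤ D₂.1# D₂.- a₂ D₂.* b₂ D₂.* q₂ ^ i
    P₂∤1-abq^ i P₂∣ = -X*≉0 {q₁ ^₁ m′} {q₁ ^₁ i D₁.* q₁ ^₁ m} (λ e → q₀^≉0 m′ (D₀.trans (D₀.sym (A.at (q₁^≈ m′) 0)) e))
      (L.∣⇒remainder≈0 β≉0 β (q₁ ^₁ m′ D₁.- A.X D₁.* (q₁ ^₁ i D₁.* q₁ ^₁ m)) (a₂ D₂.* q₂ ^ i) (begin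
        β D₂.* (D₂.1# D₂.- a₂ D₂.* b₂ D₂.* q₂ ^ i)
          ≈⟨ solve 5 (λ β α a b q → β :* (:1 :- a :* b :* q)
               := β :- a :* (q :* α) :+ (α :- β :* b) :* (a :* q)) D₂.refl β α a₂ b₂ (q₂ ^ i) ⟩
        β D₂.- a₂ D₂.* (q₂ ^ i D₂.* α) D₂.+ P₂ D₂.* (a₂ D₂.* q₂ ^ i)
          ≈⟨ D₂.+-congʳ {P₂ D₂.* (a₂ D₂.* q₂ ^ i)} (D₂.+-congˡ {β} (D₂.-‿cong (begin
               a₂ D₂.* (q₂ ^ i D₂.* α)
                 ≈⟨ D₂.*-congˡ {a₂} (D₂.*-congʳ {α} (q₂^≈ i)) ⟩
               a₂ D₂.* (B.const (q₁ ^₁ i) D₂.* α)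
                 ≈⟨ D₂.*-congˡ {a₂} (B′.const-* (q₁ ^₁ i) (q₁ ^₁ m)) ⟨
               a₂ D₂.* B.const (q₁ ^₁ i D₁.* q₁ ^₁ m)
                 ≈⟨ B′.const-* A.X (q₁ ^₁ i D₁.* q₁ ^₁ m) ⟨
               B.const (A.X D₁.* (q₁ ^₁ i D₁.* q₁ ^₁ m)) ∎))) ⟩
        B.const (q₁ ^₁ m′ D₁.- A.X D₁.* (q₁ ^₁ i D₁.* q₁ ^₁ m)) D₂.+ P₂ D₂.* (a₂ D₂.* q₂ ^ i) ∎) P₂∣)
      where
      open S₂
      open SetoidReasoning D₂.setoid
      α = B.const (q₁ ^₁ m)

    -- The same substitution leaves q^(m′+i) - q^(j+m).
    P₂∤q^-bq^ : ∀ i j → m′ ℕ.+ i ≢ j ℕ.+ m → P₂ ∤ q₂ ^ i D₂.- b₂ D₂.* q₂ ^ j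
    P₂∤q^-bq^ i j i≢j P₂∣ = i≢j (q₀^-injective _ _ (A.at (begin₁
      A.const (q₀ ^₀ (m′ ℕ.+ i))  ≈⟨ q₁^≈ (m′ ℕ.+ i) ⟨
      q₁ ^₁ (m′ ℕ.+ i)            ≈⟨ ^₁-homo-* q₁ m′ i ⟩
      q₁ ^₁ m′ D₁.* q₁ ^₁ i       ≈⟨ RingProperties.x∙y⁻¹≈ε⇒x≈y D₁.ring _ _ remainder≈0 ⟩
      q₁ ^₁ j D₁.* q₁ ^₁ m        ≈⟨ ^₁-homo-* q₁ j m ⟨
      q₁ ^₁ (j ℕ.+ m)             ≈⟨ q₁^≈ (j ℕ.+ m) ⟩
      A.const (q₀ ^₀ (j ℕ.+ m))   ∎₁) 0))
      where
      open S₂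
      open SetoidReasoning D₁.setoid renaming (begin_ to begin₁_; _∎ to _∎₁)
      α = B.const (q₁ ^₁ m)
      remainder≈0 : q₁ ^₁ m′ D₁.* q₁ ^₁ i D₁.- q₁ ^₁ j D₁.* q₁ ^₁ m D₁.≈ D₁.0#
      remainder≈0 = L.∣⇒remainder≈0 β≉0 β (q₁ ^₁ m′ D₁.* q₁ ^₁ i D₁.- q₁ ^₁ j D₁.* q₁ ^₁ m) (q₂ ^ j)
        (D₂.trans
          (solve 5 (λ β α b q q′ → β :* (q :- b :* q′) := β :* q :- q′ :* α :+ (α :- β :* b) :* q′)
            D₂.refl β α b₂ (q₂ ^ i) (q₂ ^ j))
          (D₂.+-congʳ {P₂ D₂.* q₂ ^ j} (D₂.+-cong
            (D₂.trans (D₂.*-congˡ {β} (q₂^≈ i)) (D₂.sym (B′.const-* (q₁ ^₁ m′) (q₁ ^₁ i))))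
            (D₂.-‿cong (D₂.trans (D₂.*-congʳ {α} (q₂^≈ j)) (D₂.sym (B′.const-* (q₁ ^₁ j) (q₁ ^₁ m))))))))
        P₂∣

-- Rational functions with denominators prime to the modulus

module Localisation {c ℓ} (D : IntegralDomain c ℓ) {p p′ : IntegralDomain.Carrier D}
  (p-prime : Divisibility.Prime D p) (p′-prime : Divisibility.Prime D p′) where

  private
    open module D = IntegralDomain D using (_≈_; _≉_; _+_; _*_; -_; 0#; 1#)
    open Divisibility D
    open IntegerSolver D.commutativeRing
    open SetoidReasoning D.setoid

  open FractionField D

  Regular : D.Carrier → Set _
  Regular u = p ∤ u × p′ ∤ u

  Regular⇒≉0 : ∀ {u} → Regular u → u ≉ 0#
  Regular⇒≉0 (p∤u , _) u≈0 = p∤u (∣0 u≈0)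

  Regular-1 : Regular 1#
  Regular-1 = p∤1 p-prime , p∤1 p′-prime

  Regular-* : ∀ {u v} → Regular u → Regular v → Regular (u * v)
  Regular-* (p∤u , p′∤u) (p∤v , p′∤v) =
    (λ p∣uv → [ p∤u , p∤v ]′ (split-∣ p-prime p∣uv)) ,
    (λ p′∣uv → [ p′∤u , p′∤v ]′ (split-∣ p′-prime p′∣uv))

  -- The denominator that F happens to carry may have common factors with its numerator, so
  -- membership asks only for some equal fraction with a regular denominator.
  Local : Frac → Set _
  Local F = ∃[ u ] Σ[ v ∈ D.Carrier ] Σ[ v-regular ∈ Regular v ] F ≃ frac u v (Regular⇒≉0 v-regular)

  private
    module F = CommutativeRing fracRing

  localRing : Recurrence.Subring fracRing _
  localRing = record
    { _∈     = Local
    ; ∈-resp = λ {F} {G} F≃G (u , v , v-reg , eq) → u , v , v-reg , F.trans (F.sym F≃G) eq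
    ; 1-∈    = 1# , 1# , Regular-1 , cross D.refl
    ; +-∈    = λ {F} {G} (u , v , v-reg , eq) (u′ , v′ , v′-reg , eq′) →
        u * v′ + u′ * v , v * v′ , Regular-* v-reg v′-reg ,
        F.trans (+F-cong {F} {frac u v (Regular⇒≉0 v-reg)} {G} {frac u′ v′ (Regular⇒≉0 v′-reg)} eq eq′)
          (cross D.refl)
    ; *-∈    = λ {F} {G} (u , v , v-reg , eq) (u′ , v′ , v′-reg , eq′) →
        u * u′ , v * v′ , Regular-* v-reg v′-reg ,
        F.trans (*F-cong {F} {frac u v (Regular⇒≉0 v-reg)} {G} {frac u′ v′ (Regular⇒≉0 v′-reg)} eq eq′)
          (cross D.refl)
    ; neg-∈  = λ {F} (u , v , v-reg , eq) →
        - u , v , v-reg , -F-cong {F} {frac u v (Regular⇒≉0 v-reg)} eq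
    }

  open Recurrence.Subring localRing using (Unit)

  fromDomain-∈ : ∀ u → Local (fromDomain u)
  fromDomain-∈ u = u , 1# , Regular-1 , cross D.refl

  fromDomain-+ : ∀ u v → fromDomain (u + v) ≃ fromDomain u +F fromDomain v
  fromDomain-+ u v = cross
    (solve 2 (λ u v → (u :+ v) :* (:1 :* :1) := (u :* :1 :+ v :* :1) :* :1) D.refl u v)

  fromDomain-* : ∀ u v → fromDomain (u * v) ≃ fromDomain u *F fromDomain v
  fromDomain-* u v = cross (solve 2 (λ u v → u :* v :* (:1 :* :1) := u :* v :* :1) D.refl u v)

  fromDomain-unit : ∀ {u} → Regular u → Unit (fromDomain u)
  fromDomain-unit {u} u-reg = frac 1# u (Regular⇒≉0 u-reg) , (1# , u , u-reg , cross D.refl) ,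
    cross (solve 1 (λ u → u :* :1 :* :1 := :1 :* (:1 :* u)) D.refl u)

  ⁻¹-unique : ∀ {F G} → F *F G ≃ 1F → F ⁻¹ ≃ G
  ⁻¹-unique {F} {G} FG≃1 = Recurrence.inverse-unique fracRing F (F ⁻¹) G (⁻¹-inverseʳ F F≄0) FG≃1
    where
    F≄0 : ¬ F ≃ 0F
    F≄0 F≃0 = D.1≉0 (D.trans (D.sym (D.*-identityˡ 1#)) (D.sym (D.trans (D.sym (D.zeroˡ 1#)) (uncross 0≃1))))
      where
      0≃1 : 0F ≃ 1F
      0≃1 = F.trans (F.sym (F.zeroˡ G)) (F.trans (F.sym (*F-cong {F} {0F} {G} {G} F≃0 F.refl)) FG≃1)

  ≃-frac : ∀ {F u v} (v≉0 : v ≉ 0#) → F *F fromDomain v ≃ fromDomain u → F ≃ frac u v v≉0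
  ≃-frac {frac x y _} {u} {v} v≉0 (cross eq) = cross (begin
    x * v        ≈⟨ D.*-identityʳ _ ⟨
    x * v * 1#   ≈⟨ eq ⟩
    u * (y * 1#) ≈⟨ D.*-congˡ (D.*-identityʳ y) ⟩
    u * y        ∎)

-- Integer powers of q and the modulus

module Specialisation {c ℓ c′ ℓ′ p} (R : CommutativeRing c′ ℓ′) (K : CommutativeRing c ℓ)
  (O : Recurrence.Subring K p) where

  private
    module R = CommutativeRing R
    open module K = CommutativeRing K using (_≈_; _+_; _*_; -_; _-_; 0#; 1#)
    open SemiringExp R.semiring using () renaming (_^_ to _^ᴿ_)
    open CommutativeSemiringExp K.commutativeSemiring using (_^_; ^-homo-*; ^-assocʳ; ^-congˡ; ^-distrib-*)
    open IntegerSolver K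
    open SetoidReasoning K.setoid
    open Recurrence K
    open Recurrence.Subring O
    open BasicSum K O

  record Embedding o : Set (c ⊔ ℓ ⊔ c′ ⊔ ℓ′ ⊔ p ⊔ lsuc o) where
    field
      ι          : R.Carrier → K.Carrier
      ι-1        : ι R.1# ≈ 1#
      ι-+        : ∀ u v → ι (u R.+ v) ≈ ι u + ι v
      ι-*        : ∀ u v → ι (u R.* v) ≈ ι u * ι v
      ι-neg      : ∀ u → ι (R.- u) ≈ - ι u
      ι-∈        : ∀ u → ι u ∈
      Regular    : R.Carrier → Set o
      ι-unit     : ∀ {u} → Regular u → Unit (ι u)
      _⁻¹        : K.Carrier → K.Carrier
      ⁻¹-unique  : ∀ {u v} → u * v ≈ 1# → u ⁻¹ ≈ v
      poch       : K.Carrier → K.Carrier → ℕ → K.Carrier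
      poch-zero  : ∀ u v → poch u v 0 ≈ 1#
      poch-suc   : ∀ u v k → poch u v (suc k) ≈ poch u v k * (1# - u * v ^ k)
      q₂ a₂ b₂   : R.Carrier
      pow        : ℤ → K.Carrier
      pow-+      : ∀ k → pow (+ k) ≈ ι q₂ ^ k
      pow-neg    : ∀ k → pow -[1+ k ] ≈ (ι q₂ ⁻¹) ^ suc k
      q-regular  : ∀ k → Regular (q₂ ^ᴿ k)

  module _ {o} (E : Embedding o) where
    open Embedding E

    private
      q a b : K.Carrier
      q = ι q₂
      a = ι a₂
      b = ι b₂

    ι-- : ∀ u v → ι (u R.- v) ≈ ι u - ι v
    ι-- u v = K.trans (ι-+ u (R.- v)) (K.+-congˡ (ι-neg v))

    ι-1- : ∀ u → ι (R.1# R.- u) ≈ 1# - ι u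
    ι-1- u = K.trans (ι-- R.1# u) (K.+-congʳ ι-1)

    ι-^ : ∀ u k → ι (u ^ᴿ k) ≈ ι u ^ k
    ι-^ u zero    = ι-1
    ι-^ u (suc k) = K.trans (ι-* u (u ^ᴿ k)) (K.*-congˡ (ι-^ u k))

    ι-1-a : ∀ i → ι (R.1# R.- a₂ R.* q₂ ^ᴿ i) ≈ 1# - a * q ^ i
    ι-1-a i = K.trans (ι-1- _) (1-cong (K.trans (ι-* _ _) (K.*-congˡ (ι-^ q₂ i))))

    ι-b : ∀ i j → ι (q₂ ^ᴿ i R.- b₂ R.* q₂ ^ᴿ j) ≈ q ^ i - b * q ^ j
    ι-b i j = K.trans (ι-- _ _) (K.+-cong (ι-^ q₂ i)
      (K.-‿cong (K.trans (ι-* _ _) (K.*-congˡ (ι-^ q₂ j)))))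

    q^-unit : ∀ k → Unit (q ^ k)
    q^-unit k = Unit-resp (ι-^ q₂ k) (ι-unit (q-regular k))

    private
      q-unit : Unit q
      q-unit = Unit-resp (K.*-identityʳ q) (q^-unit 1)

      q⁻¹≈ : q ⁻¹ ≈ proj₁ q-unit
      q⁻¹≈ = ⁻¹-unique (proj₂ (proj₂ q-unit))

      q⁻¹*q : q ⁻¹ * q ≈ 1#
      q⁻¹*q = K.trans (K.*-congʳ q⁻¹≈) (K.trans (K.*-comm _ _) (proj₂ (proj₂ q-unit)))

      1^ : ∀ k → 1# ^ k ≈ 1#
      1^ zero    = K.refl
      1^ (suc k) = K.trans (K.*-identityˡ _) (1^ k)

    cancel-q^ : ∀ {u v} k → u * q ^ k ≈ v * q ^ k → u ≈ v
    cancel-q^ {u} {v} k eq = begin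
      u                ≈⟨ K.*-identityʳ u ⟨
      u * 1#           ≈⟨ K.*-congˡ qq′≈1 ⟨
      u * (q ^ k * q′) ≈⟨ K.*-assoc _ _ _ ⟨
      u * q ^ k * q′   ≈⟨ K.*-congʳ eq ⟩
      v * q ^ k * q′   ≈⟨ K.*-assoc _ _ _ ⟩
      v * (q ^ k * q′) ≈⟨ K.*-congˡ qq′≈1 ⟩
      v * 1#           ≈⟨ K.*-identityʳ v ⟩
      v                ∎
      where
      q′ = proj₁ (q^-unit k)
      qq′≈1 = proj₂ (proj₂ (q^-unit k))

    -- Handles both signs of i. Powers with a possibly negative exponent are compared by first
    -- multiplying them into natural powers in this way.
    pow-*-q^ : ∀ i {m n} → i ℤ.+ + n ≡ + m → pow i * q ^ n ≈ q ^ m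
    pow-*-q^ (+ k) {m} {n} eq = begin
      pow (+ k) * q ^ n ≈⟨ K.*-congʳ (pow-+ k) ⟩
      q ^ k * q ^ n     ≈⟨ ^-homo-* q k n ⟨
      q ^ (k ℕ.+ n)     ≡⟨ ≡.cong (q ^_) (ℤₚ.+-injective eq) ⟩
      q ^ m             ∎
    pow-*-q^ -[1+ k ] {m} {n} eq = begin
      pow -[1+ k ] * q ^ n                 ≈⟨ K.*-cong (pow-neg k) (K.reflexive (≡.cong (q ^_) n≡)) ⟩
      (q ⁻¹) ^ suc k * q ^ (suc k ℕ.+ m)   ≈⟨ K.*-congˡ (^-homo-* q (suc k) m) ⟩
      (q ⁻¹) ^ suc k * (q ^ suc k * q ^ m) ≈⟨ K.*-assoc _ _ _ ⟨
      (q ⁻¹) ^ suc k * q ^ suc k * q ^ m   ≈⟨ K.*-congʳ (^-distrib-* (q ⁻¹) q (suc k)) ⟨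
      (q ⁻¹ * q) ^ suc k * q ^ m           ≈⟨ K.*-congʳ (K.trans (^-congˡ (suc k) q⁻¹*q) (1^ (suc k))) ⟩
      1# * q ^ m                           ≈⟨ K.*-identityˡ _ ⟩
      q ^ m                                ∎
      where
      n≡ : n ≡ suc k ℕ.+ m
      n≡ = ℤₚ.+-injective (≡.trans (lemma (+ suc k) (+ n)) (≡.cong (λ z → + suc k ℤ.+ z) eq))
        where
        lemma : ∀ k n → n ≡ k ℤ.+ (ℤ.- k ℤ.+ n)
        lemma = ℤ-Solver.solve-∀

    pow-∈ : ∀ i → pow i ∈
    pow-∈ (+ k)    = ∈-resp (K.sym (pow-+ k)) (^-∈ k (ι-∈ q₂))
    pow-∈ -[1+ k ] = ∈-resp (K.sym (pow-neg k))
      (^-∈ (suc k) (∈-resp (K.sym q⁻¹≈) (proj₁ (proj₂ q-unit))))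

    -- The last expression is q^r (1 - b q^(d-r+ds)); the factor q^r makes it a polynomial even when
    -- r > d.
    record Regularity (d r t t′ : ℕ) : Set o where
      field
        1-q-regular  : ∀ i → Regular (R.1# R.- q₂ ^ᴿ suc i)
        1-ab-regular : ∀ i → Regular (R.1# R.- a₂ R.* b₂ R.* q₂ ^ᴿ i)
        1-a-regular  : ∀ {s} → s ≢ t → Regular (R.1# R.- a₂ R.* q₂ ^ᴿ (r ℕ.+ d ℕ.* s))
        1-b-regular  : ∀ {s} → s ≢ t′ → Regular (q₂ ^ᴿ r R.- b₂ R.* q₂ ^ᴿ (d ℕ.+ d ℕ.* s))

    module _ (d r t t′ : ℕ) .{{_ : NonZero d}} (regular : Regularity d r t t′) where
      open Regularity regular

      private
        e e′ : ℤ
        e  = + d ℤ.- + r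
        e′ = + d ℤ.- + r ℤ.+ + d ℤ.* + t′

        e+r≡d : e ℤ.+ + r ≡ + d
        e+r≡d = lemma (+ d) (+ r)
          where
          lemma : ∀ d r → d ℤ.- r ℤ.+ r ≡ d
          lemma = ℤ-Solver.solve-∀

        e′+r≡ : e′ ℤ.+ + r ≡ + (d ℕ.+ d ℕ.* t′)
        e′+r≡ = ≡.trans (lemma (+ d) (+ r) (+ t′)) (≡.cong (λ z → + d ℤ.+ z) (≡.sym (ℤₚ.pos-* d t′)))
          where
          lemma : ∀ d r t → d ℤ.- r ℤ.+ d ℤ.* t ℤ.+ r ≡ d ℤ.+ d ℤ.* t
          lemma = ℤ-Solver.solve-∀

        pow-e*q^r : pow e * q ^ r ≈ q ^ d
        pow-e*q^r = pow-*-q^ e e+r≡d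

        pow-e*q^*q^r : ∀ s → pow e * q ^ (d ℕ.* s) * q ^ r ≈ q ^ (d ℕ.+ d ℕ.* s)
        pow-e*q^*q^r s = begin
          pow e * q ^ (d ℕ.* s) * q ^ r
            ≈⟨ solve 3 (λ e q r → e :* q :* r := e :* r :* q) K.refl (pow e) (q ^ (d ℕ.* s)) (q ^ r) ⟩
          pow e * q ^ r * q ^ (d ℕ.* s) ≈⟨ K.*-congʳ pow-e*q^r ⟩
          q ^ d * q ^ (d ℕ.* s)         ≈⟨ ^-homo-* q d (d ℕ.* s) ⟨
          q ^ (d ℕ.+ d ℕ.* s)           ∎

        setting : Setting
        setting = record
          { _⁻¹       = _⁻¹
          ; ⁻¹-unique = ⁻¹-unique
          ; poch      = poch
          ; poch-zero = poch-zero
          ; poch-suc  = poch-suc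
          ; d = d ; r = r ; t = t ; t′ = t′
          ; q = q ; a = a ; b = b ; e = pow e
          ; e*q^r     = pow-e*q^r
          ; q-∈       = ι-∈ q₂
          ; a-∈       = ι-∈ a₂
          ; b-∈       = ι-∈ b₂
          ; e-∈       = pow-∈ e
          ; 1-q^-unit = λ k → Unit-resp (K.trans (ι-1- _) (1-cong (begin
              ι (q₂ ^ᴿ suc (ℕ.pred (d ℕ.* suc k))) ≈⟨ ι-^ q₂ (suc (ℕ.pred (d ℕ.* suc k))) ⟩
              q ^ suc (ℕ.pred (d ℕ.* suc k))
                ≡⟨ ≡.cong (q ^_) (ℕₚ.suc-pred (d ℕ.* suc k) {{ℕₚ.m*n≢0 d (suc k)}}) ⟩
              q ^ (d ℕ.* suc k)                    ≈⟨ ^-assocʳ q d (suc k) ⟨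
              q ^ d * (q ^ d) ^ k                  ∎)))
              (ι-unit (1-q-regular (ℕ.pred (d ℕ.* suc k))))
          ; 1-ab-unit = λ i → Unit-resp (K.trans (ι-1- _) (1-cong
              (K.trans (ι-* _ _) (K.*-cong (ι-* a₂ b₂) (ι-^ q₂ i))))) (ι-unit (1-ab-regular i))
          ; 1-a-unit  = λ {s} s≢t → Unit-resp (ι-1-a (r ℕ.+ d ℕ.* s)) (ι-unit (1-a-regular s≢t))
          ; 1-b-unit  = λ {s} s≢t′ → unit-b s (ι-unit (1-b-regular s≢t′))
          }
          where
          unit-b : ∀ s → Unit (ι (q₂ ^ᴿ r R.- b₂ R.* q₂ ^ᴿ (d ℕ.+ d ℕ.* s))) →
            Unit (1# - b * (pow e * q ^ (d ℕ.* s)))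
          -- As v inverts q^r (1 - yQ^s), the product q^r v inverts 1 - yQ^s.
          unit-b s (v , v∈ , eq) = q ^ r * v , *-∈ (^-∈ r (ι-∈ q₂)) v∈ , (begin
            (1# - b * (pow e * q ^ (d ℕ.* s))) * (q ^ r * v)
              ≈⟨ solve 4 (λ b w r v → (:1 :- b :* w) :* (r :* v) := (r :- b :* (w :* r)) :* v)
                   K.refl b (pow e * q ^ (d ℕ.* s)) (q ^ r) v ⟩
            (q ^ r - b * (pow e * q ^ (d ℕ.* s) * q ^ r)) * v
              ≈⟨ K.*-congʳ (K.+-congˡ (K.-‿cong (K.*-congˡ (pow-e*q^*q^r s)))) ⟩
            (q ^ r - b * q ^ (d ℕ.+ d ℕ.* s)) * v
              ≈⟨ K.*-congʳ (ι-b r (d ℕ.+ d ℕ.* s)) ⟨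
            ι (q₂ ^ᴿ r R.- b₂ R.* q₂ ^ᴿ (d ℕ.+ d ℕ.* s)) * v
              ≈⟨ eq ⟩
            1# ∎)

        pow-e′ : pow e * q ^ (d ℕ.* t′) ≈ pow e′
        pow-e′ = cancel-q^ r (K.trans (pow-e*q^*q^r t′) (K.sym (pow-*-q^ e′ e′+r≡)))

      modulus : K.Carrier
      modulus = (1# - a * q ^ (r ℕ.+ d ℕ.* t)) * (1# - b * pow e′)

      ∑-divisible-by-modulus : ∀ n s → s ≤ n → t < n → t′ < n →
        (∀ i → 2 ℕ.* i ℕ.+ s ≢ t) → (∀ i → 2 ℕ.* i ℕ.+ s ≢ t′) →
        ∃[ V ] V ∈ × ∑< (n ∸ s) (λ j → summand setting s (s ℕ.+ j)) ≈ modulus * V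
      ∑-divisible-by-modulus n s s≤n t<n t′<n s≢t s≢t′ =
        let V , V∈ , eq = ∑-divisible setting n s s≤n t<n t′<n s≢t s≢t′
        in V , V∈ , K.trans eq (K.*-congʳ (K.*-congˡ (1-cong (K.*-congˡ pow-e′))))

    modulus-numerator : ∀ {m m′} i u → i ℤ.+ + m ≡ + m′ →
      (1# - a * q ^ u) * (1# - b * pow i) * q ^ m
      ≈ ι ((R.1# R.- a₂ R.* q₂ ^ᴿ u) R.* (q₂ ^ᴿ m R.- b₂ R.* q₂ ^ᴿ m′))
    modulus-numerator {m} {m′} i u eq = begin
      (1# - a * q ^ u) * (1# - b * pow i) * q ^ m
        ≈⟨ solve 4 (λ A b w m → A :* (:1 :- b :* w) :* m := A :* (m :- b :* (w :* m)))
             K.refl (1# - a * q ^ u) b (pow i) (q ^ m) ⟩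
      (1# - a * q ^ u) * (q ^ m - b * (pow i * q ^ m))
        ≈⟨ K.*-congˡ (K.+-congˡ (K.-‿cong (K.*-congˡ (pow-*-q^ i eq)))) ⟩
      (1# - a * q ^ u) * (q ^ m - b * q ^ m′)
        ≈⟨ K.*-cong (ι-1-a u) (ι-b m m′) ⟨
      ι (R.1# R.- a₂ R.* q₂ ^ᴿ u) * ι (q₂ ^ᴿ m R.- b₂ R.* q₂ ^ᴿ m′)
        ≈⟨ ι-* _ _ ⟨
      ι ((R.1# R.- a₂ R.* q₂ ^ᴿ u) R.* (q₂ ^ᴿ m R.- b₂ R.* q₂ ^ᴿ m′)) ∎

module RingIdentities {c ℓ} (K : CommutativeRing c ℓ) where

  open CommutativeRing K
  open IntegerSolver K
  open SetoidReasoning setoid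

  x-0≈x : ∀ x → x - 0# ≈ x
  x-0≈x = solve 1 (λ x → x :- :0 := x) refl

  exchange : ∀ F M W V P → M * W ≈ 1# → F * M ≈ P → F * V ≈ P * (W * V)
  exchange F M W V P MW≈1 FM≈P = begin
    F * V             ≈⟨ *-congʳ (*-identityʳ F) ⟨
    F * 1# * V        ≈⟨ *-congʳ (*-congˡ MW≈1) ⟨
    F * (M * W) * V   ≈⟨ solve 4 (λ F M W V → F :* (M :* W) :* V := F :* M :* (W :* V)) refl F M W V ⟩
    F * M * (W * V)   ≈⟨ *-congʳ FM≈P ⟩
    P * (W * V)       ∎

-- The congruence over a general base domain D₀

module Congruence {c ℓ} (D₀ : IntegralDomain c ℓ) (q₀ : IntegralDomain.Carrier D₀)
  (q₀^-injective : ∀ i j → IntegralDomain._≈_ D₀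
     (SemiringExp._^_ (IntegralDomain.semiring D₀) q₀ i)
     (SemiringExp._^_ (IntegralDomain.semiring D₀) q₀ j) → i ≡ j) where

  private
    open module 𝓜 = Moduli D₀ q₀ q₀^-injective using (q₂; a₂; b₂)
    D = PolynomialDomain.polyDomain (PolynomialDomain.polyDomain D₀)
    module D = IntegralDomain D
    open SemiringExp D.semiring using () renaming (_^_ to _^ᴰ_)
    open FractionField D
    module K = CommutativeRing fracRing
    open SemiringExp K.semiring using (_^_)
    open Divisibility D using (Coprime; coprime-*ʳ)

    q a b : Frac
    q = fromDomain q₂
    a = fromDomain a₂
    b = fromDomain b₂

  record Operations : Set (c ⊔ ℓ) where
    field
      poch       : Frac → Frac → ℕ → Frac
      poch-zero  : ∀ u v → poch u v 0 ≃ 1F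
      poch-suc   : ∀ u v k → poch u v (suc k) ≃ poch u v k *F (1F K.- u *F v ^ k)
      pow        : ℤ → Frac
      pow-+      : ∀ k → pow (+ k) ≃ q ^ k
      pow-neg    : ∀ k → pow -[1+ k ] ≃ (q ⁻¹) ^ suc k

  module _ (ops : Operations) where
    open Operations ops

    summandF : ℕ → ℕ → ℕ → ℕ → Frac
    summandF d r s k =
      (poch (a *F q ^ r) (q ^ d) k *F poch (b *F pow (+ d ℤ.- + r)) (q ^ d) k
        *F poch (q ^ d) (q ^ (2 ℕ.* d)) k *F q ^ (d ℕ.* k))
      /F (poch (q ^ d) (q ^ d) (k ∸ s) *F poch (q ^ d) (q ^ d) (k ℕ.+ s)
        *F poch (a *F b *F q ^ (2 ℕ.* d)) (q ^ (2 ℕ.* d)) k)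

    modulusF : ℕ → ℕ → ℕ → ℕ → Frac
    modulusF d r t t′ =
      (1F K.- a *F q ^ (r ℕ.+ d ℕ.* t)) *F (1F K.- b *F pow (+ d ℤ.- + r ℤ.+ + d ℤ.* + t′))

    -- This and `Vanishes` unfold, for D₀ = ℚ[q], to the notions in the statement of the theorem.
    IsNumerator : D.Carrier → Frac → Set _
    IsNumerator P F = ∃[ M ] Σ (M D.≉ D.0#) λ M≉0 → Coprime P M × F ≃ frac P M M≉0

    Vanishes : Frac → D.Carrier → Set _
    Vanishes A P = ∃[ C ] ∃[ E ] Σ (E D.≉ D.0#) λ E≉0 → Coprime E P × A K.- 0F ≃ fromDomain P *F frac C E E≉0

    module _ (d r t t′ m m′ : ℕ) .{{_ : NonZero d}} (mm′ : m ≡ 0 ⊎ m′ ≡ 0)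
      (exponent : + d ℤ.- + r ℤ.+ + d ℤ.* + t′ ℤ.+ + m ≡ + m′) where

      private
        u = r ℕ.+ d ℕ.* t
        P₁ = 𝓜.P₁ u
        P₂ = 𝓜.P₂ m m′ mm′
        P₁-prime = 𝓜.P₁-prime u
        P₂-prime = 𝓜.P₂-prime m m′ mm′

        open Localisation D P₁-prime P₂-prime
        open Specialisation D.commutativeRing fracRing localRing

        embedding : Embedding _
        embedding = record
          { ι         = fromDomain
          ; ι-1       = K.refl
          ; ι-+       = fromDomain-+
          ; ι-*       = fromDomain-*
          ; ι-neg     = λ _ → K.refl
          ; ι-∈       = fromDomain-∈
          ; Regular   = Regular
          ; ι-unit    = fromDomain-unit
          ; _⁻¹       = _⁻¹
          ; ⁻¹-unique = λ {F} {G} → ⁻¹-unique {F} {G}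
          ; poch      = poch
          ; poch-zero = poch-zero
          ; poch-suc  = poch-suc
          ; q₂        = q₂
          ; a₂        = a₂
          ; b₂        = b₂
          ; pow       = pow
          ; pow-+     = pow-+
          ; pow-neg   = pow-neg
          ; q-regular = λ k → 𝓜.P₁∤q^ u k , 𝓜.P₂∤q^ m m′ mm′ k
          }

        -- The equation m′ - m = d - r + d t′ without subtraction. It turns s ≢ t′ into the
        -- inequality of exponents that `P₂∤q^-bq^` asks for.
        exponent-ℕ : m′ ℕ.+ r ≡ d ℕ.+ d ℕ.* t′ ℕ.+ m
        exponent-ℕ = ℤₚ.+-injective (begin
          + m′ ℤ.+ + r
            ≡⟨ ≡.cong (λ z → z ℤ.+ + r) exponent ⟨
          + d ℤ.- + r ℤ.+ + d ℤ.* + t′ ℤ.+ + m ℤ.+ + r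
            ≡⟨ lemma (+ d) (+ r) (+ t′) (+ m) ⟩
          + d ℤ.+ + d ℤ.* + t′ ℤ.+ + m
            ≡⟨ ≡.cong (λ z → + d ℤ.+ z ℤ.+ + m) (ℤₚ.pos-* d t′) ⟨
          + (d ℕ.+ d ℕ.* t′ ℕ.+ m) ∎)
          where
          open ≡-Reasoning
          lemma : ∀ d r t m → d ℤ.- r ℤ.+ d ℤ.* t ℤ.+ m ℤ.+ r ≡ d ℤ.+ d ℤ.* t ℤ.+ m
          lemma = ℤ-Solver.solve-∀

        regularity : Regularity embedding d r t t′
        regularity = record
          { 1-q-regular  = λ i → 𝓜.P₁∤1-q^ u i , 𝓜.P₂∤1-q^ m m′ mm′ i
          ; 1-ab-regular = λ i → 𝓜.P₁∤1-abq^ u i , 𝓜.P₂∤1-abq^ m m′ mm′ i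
          ; 1-a-regular  = λ {s} s≢t → 𝓜.P₁∤1-aq^ u (r ℕ.+ d ℕ.* s) (λ eq → s≢t
              (≡.sym (ℕₚ.*-cancelˡ-≡ t s d (ℕₚ.+-cancelˡ-≡ r (d ℕ.* t) (d ℕ.* s) eq)))) ,
              𝓜.P₂∤1-aq^ m m′ mm′ (r ℕ.+ d ℕ.* s)
          ; 1-b-regular  = λ {s} s≢t′ → 𝓜.P₁∤q^-bq^ u r (d ℕ.+ d ℕ.* s) ,
              𝓜.P₂∤q^-bq^ m m′ mm′ r (d ℕ.+ d ℕ.* s) (λ eq → s≢t′
                (≡.sym (ℕₚ.*-cancelˡ-≡ t′ s d (ℕₚ.+-cancelˡ-≡ d (d ℕ.* t′) (d ℕ.* s)
                  (ℕₚ.+-cancelʳ-≡ m (d ℕ.+ d ℕ.* t′) (d ℕ.+ d ℕ.* s) (≡.trans (≡.sym exponent-ℕ) eq))))))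
          }

        F : Frac
        F = modulusF d r t t′

        P M : D.Carrier
        P = P₁ D.* P₂
        M = q₂ ^ᴰ m

        M-regular : Regular M
        M-regular = 𝓜.P₁∤q^ u m , 𝓜.P₂∤q^ m m′ mm′ m

        F*M≃P : F *F fromDomain M ≃ fromDomain P
        F*M≃P = K.trans (*F-cong {F} {F} {fromDomain M} {q ^ m} K.refl (ι-^ embedding q₂ m))
          (K.trans (modulus-numerator embedding (+ d ℤ.- + r ℤ.+ + d ℤ.* + t′) u exponent)
            (cross (D.*-congʳ {D.1#} (D.sym (D.*-cong (𝓜.P₁≈ u) (𝓜.P₂≈ m m′ mm′))))))

        coprime-regular : ∀ {v} → Regular v → Coprime v P
        coprime-regular (P₁∤v , P₂∤v) = coprime-*ʳ P₁-prime P₂-prime P₁∤v P₂∤v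

        numerator : IsNumerator P F
        numerator = M , Regular⇒≉0 M-regular ,
          (λ z∣P z∣M → coprime-regular M-regular z∣M z∣P) , ≃-frac {F} (Regular⇒≉0 M-regular) F*M≃P

        -- F = P/M, where M = q^m is a unit of the local ring with inverse W. Hence F V = P (W V),
        -- and a regular denominator of W V is coprime to P.
        multiple-vanishes : ∀ {A V} → Local V → A ≃ F *F V → Vanishes A P
        multiple-vanishes {A} {V} V∈ A≃FV =
          let W , W∈ , MW≃1 = fromDomain-unit M-regular
              C , E , E-regular , WV≃ = Subring.*-∈ localRing {W} {V} W∈ V∈
          in C , E , Regular⇒≉0 E-regular , coprime-regular E-regular ,
             K.trans (RingIdentities.x-0≈x fracRing A) (K.trans A≃FV (K.trans
               (RingIdentities.exchange fracRing F (fromDomain M) W V (fromDomain P) MW≃1 F*M≃P)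
               (*F-cong {fromDomain P} {fromDomain P} {W *F V} {frac C E (Regular⇒≉0 E-regular)} K.refl WV≃)))
          where
          open Recurrence fracRing using (module Subring)

      vanishing : ∀ n s → s ≤ n → t < n → t′ < n →
        (∀ i → 2 ℕ.* i ℕ.+ s ≢ t) → (∀ i → 2 ℕ.* i ℕ.+ s ≢ t′) →
        ∃[ P ] IsNumerator P (modulusF d r t t′)
          × Vanishes (Recurrence.∑< fracRing (n ∸ s) (λ j → summandF d r s (s ℕ.+ j))) P
      vanishing n s s≤n t<n t′<n s≢t s≢t′ =
        let V , V∈ , eq = ∑-divisible-by-modulus embedding d r t t′ regularity n s s≤n t<n t′<n s≢t s≢t′
        in P , numerator , multiple-vanishes {V = V} V∈ eq

-- Residues

module Residues where

  import Data.Integer.DivMod as ℤ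
  import Data.Integer.Divisibility.Signed as ℤ
  open import Data.Nat.Divisibility using (_∣_; _∣?_; divides; ∣-trans)

  -- Reducing i/d to lowest terms divides i by g = gcd(i,d), and g, as a divisor of d, is coprime to
  -- n.
  numerator-∣ : ∀ {d′ n} z i → Coprimality.Coprime (suc d′) n → toℚᵘ z ≃ᵘ mkℚᵘ i d′ →
    (n ∣ ℤ.∣ ↥ z ∣ → + n ℤ.∣ i) × (+ n ℤ.∣ i → n ∣ ℤ.∣ ↥ z ∣)
  numerator-∣ {d′} {n} z i d⊥n z≃ = to , from
    where
    g : ℤ
    g = gcdℤ i (+ suc d′)
    ↥z*g≡i : ↥ z ℤ.* g ≡ i
    ↥z*g≡i = ≡.subst (λ y → ↥ y ℤ.* g ≡ i)
      (≡.trans (≡.sym (ℚₚ.fromℚᵘ-cong z≃)) (ℚₚ.fromℚᵘ-toℚᵘ z)) (ℚₚ.↥-/ i (suc d′))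
    to : n ∣ ℤ.∣ ↥ z ∣ → + n ℤ.∣ i
    to n∣z = ≡.subst (+ n ℤ.∣_) ↥z*g≡i (ℤ.∣m⇒∣m*n {m = ↥ z} g (ℤ.∣ᵤ⇒∣ n∣z))
    n⊥g : Coprimality.Coprime n ℤ.∣ g ∣
    n⊥g (k∣n , k∣g) = d⊥n (∣-trans k∣g (gcd[m,n]∣n ℤ.∣ i ∣ (suc d′)) , k∣n)
    from : + n ℤ.∣ i → n ∣ ℤ.∣ ↥ z ∣
    from n∣i = coprime-divisor n⊥g (≡.subst (n ∣_)
      (≡.trans (≡.cong ℤ.∣_∣ (≡.sym (≡.trans (ℤₚ.*-comm g (↥ z)) ↥z*g≡i))) (ℤₚ.abs-* g (↥ z)))
      (ℤ.∣⇒∣ᵤ n∣i))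

  -- Bézout gives c with c d ≡ 1 modulo n, and j is the remainder of i c.
  residue-exists : ∀ {d n} .{{_ : NonZero n}} i → Coprimality.Coprime d n → ∃[ j ] j < n × + n ℤ.∣ i ℤ.- + d ℤ.* + j
  residue-exists {d} {n} i d⊥n with inverse (coprime-Bézout d⊥n)
    where
    inverse : Bézout.Identity 1 d n → ∃[ c ] + n ℤ.∣ (+ 1 ℤ.- c ℤ.* + d)
    inverse (Bézout.+- x y eq) = + x , ℤ.divides (ℤ.- + y) (begin
      + 1 ℤ.- + x ℤ.* + d                       ≡⟨ ≡.cong (λ z → + 1 ℤ.- z) (≡.trans (≡.sym (ℤₚ.pos-* x d)) (≡.cong +_ (≡.sym eq))) ⟩
      + 1 ℤ.- (+ 1 ℤ.+ + (y ℕ.* n))             ≡⟨ ≡.cong (λ z → + 1 ℤ.- (+ 1 ℤ.+ z)) (ℤₚ.pos-* y n) ⟩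
      + 1 ℤ.- (+ 1 ℤ.+ + y ℤ.* + n)             ≡⟨ lemma (+ y) (+ n) ⟩
      ℤ.- + y ℤ.* + n                           ∎)
      where
      open ≡-Reasoning
      lemma : ∀ y n → + 1 ℤ.- (+ 1 ℤ.+ y ℤ.* n) ≡ ℤ.- y ℤ.* n
      lemma = ℤ-Solver.solve-∀
    inverse (Bézout.-+ x y eq) = ℤ.- + x , ℤ.divides (+ y) (begin
      + 1 ℤ.- ℤ.- + x ℤ.* + d  ≡⟨ lemma (+ x) (+ d) ⟩
      + 1 ℤ.+ + x ℤ.* + d      ≡⟨ ≡.cong (λ z → + 1 ℤ.+ z) (ℤₚ.pos-* x d) ⟨
      + (1 ℕ.+ x ℕ.* d)        ≡⟨ ≡.cong +_ eq ⟩
      + (y ℕ.* n)              ≡⟨ ℤₚ.pos-* y n ⟩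
      + y ℤ.* + n              ∎)
      where
      open ≡-Reasoning
      lemma : ∀ x d → + 1 ℤ.- ℤ.- x ℤ.* d ≡ + 1 ℤ.+ x ℤ.* d
      lemma = ℤ-Solver.solve-∀
  ... | c , n∣1-cd = (i ℤ.* c) ℤ.%ℕ n , ℤ.n%ℕd<d (i ℤ.* c) n ,
    ≡.subst (+ n ℤ.∣_) (begin
      -- A form of i - d j in which n visibly divides both terms; k is the quotient of i c by n.
      i ℤ.* (+ 1 ℤ.- c ℤ.* + d) ℤ.+ + d ℤ.* k ℤ.* + n           ≡⟨ lemma₁ i c (+ d) k (+ n) ⟩
      i ℤ.- + d ℤ.* (i ℤ.* c) ℤ.+ + d ℤ.* k ℤ.* + n             ≡⟨ ≡.cong (λ z → i ℤ.- + d ℤ.* z ℤ.+ + d ℤ.* k ℤ.* + n)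
                                                                    (ℤ.a≡a%ℕn+[a/ℕn]*n (i ℤ.* c) n) ⟩
      i ℤ.- + d ℤ.* (+ j ℤ.+ k ℤ.* + n) ℤ.+ + d ℤ.* k ℤ.* + n   ≡⟨ lemma₂ i (+ d) (+ j) k (+ n) ⟩
      i ℤ.- + d ℤ.* + j                                         ∎)
    (ℤ.∣m∣n⇒∣m+n (ℤ.∣n⇒∣m*n i n∣1-cd) (ℤ.∣n⇒∣m*n (+ d ℤ.* k) ℤ.∣-refl))
    where
    open ≡-Reasoning
    j = (i ℤ.* c) ℤ.%ℕ n
    k = (i ℤ.* c) ℤ./ℕ n
    lemma₁ : ∀ i c d k n → i ℤ.* (+ 1 ℤ.- c ℤ.* d) ℤ.+ d ℤ.* k ℤ.* n ≡ i ℤ.- d ℤ.* (i ℤ.* c) ℤ.+ d ℤ.* k ℤ.* n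
    lemma₁ = ℤ-Solver.solve-∀
    lemma₂ : ∀ i d j k n → i ℤ.- d ℤ.* (j ℤ.+ k ℤ.* n) ℤ.+ d ℤ.* k ℤ.* n ≡ i ℤ.- d ℤ.* j
    lemma₂ = ℤ-Solver.solve-∀

  head-∈ : ∀ {A : Set} {x y : A} {xs} → x ∈ xs → fromMaybe y (head xs) ∈ xs
  head-∈ {xs = _ ∷ _} _ = here ≡.refl

  -- By `residue-exists` the filtered list is not empty, so the default 0 is not reached and the
  -- head passes the test. The unreduced numerator of x - j is i - d j.
  residue-spec : ∀ {d′ n} .{{_ : NonZero n}} x i → Coprimality.Coprime (suc d′) n → toℚᵘ x ≃ᵘ mkℚᵘ i d′ →
    ⟨ x ⟩ n < n × + n ℤ.∣ i ℤ.- + suc d′ ℤ.* + (⟨ x ⟩ n)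
  residue-spec {d′} {n} x i d⊥n x≃ =
    let j , j<n , n∣ = residue-exists i d⊥n
        t∈upTo , n∣t = ∈-filter⁻ P? {xs = upTo n}
          (head-∈ (∈-filter⁺ P? (∈-upTo⁺ j<n) (proj₂ (equiv j) n∣)))
    in ∈-upTo⁻ t∈upTo , proj₁ (equiv (⟨ x ⟩ n)) n∣t
    where
    P? = λ j → n ∣? ℤ.∣ ↥ (x ℚ.- (+ j) ℚ./ 1) ∣
    x-j≃ : ∀ j → toℚᵘ (x ℚ.- (+ j) ℚ./ 1) ≃ᵘ mkℚᵘ (i ℤ.- + suc d′ ℤ.* + j) d′
    x-j≃ j = begin
      toℚᵘ (x ℚ.- (+ j) ℚ./ 1)               ≈⟨ ℚₚ.toℚᵘ-homo-+ x (ℚ.- ((+ j) ℚ./ 1)) ⟩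
      toℚᵘ x ℚᵘ.+ toℚᵘ (ℚ.- ((+ j) ℚ./ 1))   ≈⟨ ℚᵘₚ.+-cong x≃ (ℚᵘₚ.≃-trans (ℚₚ.toℚᵘ-homo‿- ((+ j) ℚ./ 1))
                                                  (ℚᵘₚ.-‿cong (ℚₚ.toℚᵘ-fromℚᵘ (mkℚᵘ (+ j) 0)))) ⟩
      mkℚᵘ i d′ ℚᵘ.+ ℚᵘ.- mkℚᵘ (+ j) 0       ≈⟨ *≡* (≡.trans (lemma i (+ suc d′) (+ j))
                                                  (≡.cong (λ e → (i ℤ.- + suc d′ ℤ.* + j) ℤ.* + suc e) (≡.sym (ℕₚ.*-identityʳ d′)))) ⟩
      mkℚᵘ (i ℤ.- + suc d′ ℤ.* + j) d′       ∎
      where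
      open import Relation.Binary.Reasoning.Setoid ℚᵘₚ.≃-setoid
      lemma : ∀ i d j → (i ℤ.* + 1 ℤ.+ ℤ.- j ℤ.* d) ℤ.* d ≡ (i ℤ.- d ℤ.* j) ℤ.* d
      lemma = ℤ-Solver.solve-∀
    equiv : ∀ j → _
    equiv j = numerator-∣ (x ℚ.- (+ j) ℚ./ 1) (i ℤ.- + suc d′ ℤ.* + j) d⊥n (x-j≃ j)

  -- Adding the two divisibilities gives n ∣ d (t + t′ + 1), and d cancels by coprimality. Since 0 <
  -- t + t′ + 1 < 2n, the only possible multiple is n.
  complementary-residues : ∀ {d n t t′} i j → Coprimality.Coprime d n → t < n → t′ < n →
    + n ℤ.∣ i ℤ.- + d ℤ.* + t → + n ℤ.∣ j ℤ.- + d ℤ.* + t′ → i ℤ.+ j ≡ ℤ.- + d →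
    suc (t ℕ.+ t′) ≡ n
  complementary-residues {d} {n} {t} {t′} i j d⊥n t<n t′<n n∣i n∣j i+j≡-d =
    unique (coprime-divisor (Coprimality.sym d⊥n) (≡.subst (n ∣_) (begin
      ℤ.∣ (i ℤ.- + d ℤ.* + t) ℤ.+ (j ℤ.- + d ℤ.* + t′) ∣
        ≡⟨ ≡.cong ℤ.∣_∣ (lemma₁ i j (+ d) (+ t) (+ t′)) ⟩
      ℤ.∣ (i ℤ.+ j) ℤ.- + d ℤ.* (+ t ℤ.+ + t′) ∣
        ≡⟨ ≡.cong (λ z → ℤ.∣ z ℤ.- + d ℤ.* (+ t ℤ.+ + t′) ∣) i+j≡-d ⟩
      ℤ.∣ ℤ.- + d ℤ.- + d ℤ.* (+ t ℤ.+ + t′) ∣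
        ≡⟨ ≡.cong ℤ.∣_∣ (lemma₂ (+ d) (+ (t ℕ.+ t′))) ⟩
      ℤ.∣ ℤ.- (+ d ℤ.* + suc (t ℕ.+ t′)) ∣
        ≡⟨ ℤₚ.∣-i∣≡∣i∣ (+ d ℤ.* + suc (t ℕ.+ t′)) ⟩
      ℤ.∣ + d ℤ.* + suc (t ℕ.+ t′) ∣
        ≡⟨ ℤₚ.abs-* (+ d) (+ suc (t ℕ.+ t′)) ⟩
      d ℕ.* suc (t ℕ.+ t′) ∎)
      (ℤ.∣⇒∣ᵤ (ℤ.∣m∣n⇒∣m+n n∣i n∣j))))
    where
    open ≡-Reasoning
    lemma₁ : ∀ i j d t t′ → (i ℤ.- d ℤ.* t) ℤ.+ (j ℤ.- d ℤ.* t′) ≡ (i ℤ.+ j) ℤ.- d ℤ.* (t ℤ.+ t′)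
    lemma₁ = ℤ-Solver.solve-∀
    lemma₂ : ∀ d u → ℤ.- d ℤ.- d ℤ.* u ≡ ℤ.- (d ℤ.* (+ 1 ℤ.+ u))
    lemma₂ = ℤ-Solver.solve-∀
    unique : n ∣ suc (t ℕ.+ t′) → suc (t ℕ.+ t′) ≡ n
    unique (divides (suc zero) eq)    = ≡.trans eq (ℕₚ.+-identityʳ n)
    unique (divides (suc (suc k)) eq) = contradiction (ℕₚ.+-mono-≤ t<n t′<n)
      (ℕₚ.<⇒≱ (ℕ.s≤s (≡.subst₂ ℕ._≤_ (≡.refl {x = n ℕ.+ n}) (≡.trans (≡.sym eq) (≡.sym (ℕₚ.+-suc t t′)))
        (ℕₚ.+-monoʳ-≤ n (ℕₚ.m≤m+n n (k ℕ.* n))))))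

  +-even : ∀ x y → x % 2 ≡ y % 2 → (x ℕ.+ y) % 2 ≡ 0
  +-even x y eq = ≡.trans (%-distribˡ-+ x y 2)
    (≡.trans (≡.cong (λ z → (z ℕ.+ y % 2) % 2) eq) (double (y % 2) (m%n<n y 2)))
    where
    double : ∀ z → z < 2 → (z ℕ.+ z) % 2 ≡ 0
    double 0 _ = ≡.refl
    double 1 _ = ≡.refl
    double (suc (suc _)) (ℕ.s≤s (ℕ.s≤s ()))

  [2i+s]%2 : ∀ i s → (2 ℕ.* i ℕ.+ s) % 2 ≡ s % 2
  [2i+s]%2 i s = ≡.trans (≡.cong (_% 2) (≡.trans (ℕₚ.+-comm (2 ℕ.* i) s) (≡.cong (s ℕ.+_) (ℕₚ.*-comm 2 i))))
    ([m+kn]%n≡m%n s i 2)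

  module _ {n t t′ s : ℕ} (n-odd : n % 2 ≡ 1) (t+t′ : suc (t ℕ.+ t′) ≡ n) (s≡t+1 : s % 2 ≡ (t ℕ.+ 1) % 2) where

    parity-≢ : ∀ i → 2 ℕ.* i ℕ.+ s ≢ t
    parity-≢ i ≡.refl = contradiction (≡.trans (≡.sym (+-even t (t ℕ.+ 1)
      (≡.trans ([2i+s]%2 i s) s≡t+1))) (odd t)) λ ()
      where
      odd : ∀ t → (t ℕ.+ (t ℕ.+ 1)) % 2 ≡ 1
      odd t = ≡.trans (≡.cong (_% 2) (lemma t)) ([m+kn]%n≡m%n 1 t 2)
        where
        lemma : ∀ t → t ℕ.+ (t ℕ.+ 1) ≡ 1 ℕ.+ t ℕ.* 2
        lemma = ℕ-Solver.solve-∀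

    -- Otherwise t′ ≡ s ≡ t + 1 modulo 2, and n = t + t′ + 1 would be even.
    parity-≢′ : ∀ i → 2 ℕ.* i ℕ.+ s ≢ t′
    parity-≢′ i ≡.refl = contradiction (≡.trans (≡.sym (+-even t′ (t ℕ.+ 1)
      (≡.trans ([2i+s]%2 i s) s≡t+1))) (≡.trans (≡.cong (_% 2) (≡.trans (lemma t t′) t+t′)) n-odd)) λ ()
      where
      lemma : ∀ t t′ → t′ ℕ.+ (t ℕ.+ 1) ≡ suc (t ℕ.+ t′)
      lemma = ℕ-Solver.solve-∀

-- The theorem over ℚ(q,a,b)

open import Defs
open Residues using (residue-spec; complementary-residues; parity-≢; parity-≢′)

private
  module ℚ[q]′ = PolynomialLemmas ℚ-domain
  module 𝓒 = Congruence ℚ[q].polyDomain ℚ[q].X ℚ[q]′.X^-injective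
  module K = CommutativeRing ℚ⟨q,a,b⟩.fracRing

  operations : 𝓒.Operations
  operations = record
    { poch      = ⦅_⸴_⦆_
    ; poch-zero = λ _ _ → K.refl
    ; poch-suc  = λ _ _ _ → K.refl
    ; pow       = q ^ℤ_
    ; pow-+     = λ _ → K.refl
    ; pow-neg   = λ _ → K.refl
    }

  -- The negative and positive parts of e: q^m clears exactly the denominator of q^e.
  split-exponent : ∀ e → ∃[ m ] ∃[ m′ ] (m ≡ 0 ⊎ m′ ≡ 0) × e ℤ.+ + m ≡ + m′
  split-exponent (+ k)    = 0 , k , inj₁ ≡.refl , ℤₚ.+-identityʳ (+ k)
  split-exponent -[1+ k ] = suc k , 0 , inj₂ ≡.refl , ℤₚ.n⊖n≡0 (suc k)

theorem1p1 : (d n r : ℕ) .{{_ : NonZero d}} .{{_ : NonZero n}} .{{_ : NonZero r}} →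
    gcd d n ≡ 1 → n % 2 ≡ 1 →
    (s : ℕ) → s ≤ n ∸ 1 → s % 2 ≡ (⟨ ℚ.- ((+ r) ℚ./ d) ⟩ n ℕ.+ 1) % 2 →
    ∑[ s ≤k< n ] (λ k →
    (⦅ a * q ^ r ⸴ q ^ d ⦆ k * ⦅ b * q ^ℤ (+ d ℤ.- + r) ⸴ q ^ d ⦆ k * ⦅ q ^ d ⸴ q ^ (2 ℕ.* d) ⦆ k * q ^ (d ℕ.* k))
    / (⦅ q ^ d ⸴ q ^ d ⦆ (k ∸ s) * ⦅ q ^ d ⸴ q ^ d ⦆ (k ℕ.+ s) * ⦅ a * b * q ^ (2 ℕ.* d) ⸴ q ^ (2 ℕ.* d) ⦆ k))
    ≡ 0# [mod
    (1# - a * q ^ (r ℕ.+ d ℕ.* ⟨ ℚ.- ((+ r) ℚ./ d) ⟩ n))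
    * (1# - b * q ^ℤ (+ d ℤ.- + r ℤ.+ + d ℤ.* + (⟨ (+ r ℤ.- + d) ℚ./ d ⟩ n))) ]
theorem1p1 zero n r _ _ _ _ _ = contradiction ≡.refl (ℕ.≢-nonZero⁻¹ 0)
theorem1p1 d@(suc d′) n r gcd≡1 n-odd s s≤n-1 s≡t+1 =
  let m , m′ , mm′ , exponent = split-exponent (+ d ℤ.- + r ℤ.+ + d ℤ.* + t′)
  in 𝓒.vanishing operations d r t t′ m m′ mm′ exponent n s (ℕₚ.≤-trans s≤n-1 (ℕₚ.m∸n≤m n 1))
       t<n t′<n (parity-≢ n-odd t+t′ s≡t+1) (parity-≢′ n-odd t+t′ s≡t+1)
  where
  x x′ : ℚ.ℚ
  x  = ℚ.- ((+ r) ℚ./ d)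
  x′ = (+ r ℤ.- + d) ℚ./ d
  t t′ : ℕ
  t  = ⟨ x ⟩ n
  t′ = ⟨ x′ ⟩ n
  d⊥n = Coprimality.gcd≡1⇒coprime gcd≡1
  t-spec = residue-spec x (ℤ.- + r) d⊥n
    (ℚᵘₚ.≃-trans (ℚₚ.toℚᵘ-homo‿- ((+ r) ℚ./ d)) (ℚᵘₚ.-‿cong (ℚₚ.toℚᵘ-fromℚᵘ (mkℚᵘ (+ r) d′))))
  t′-spec = residue-spec x′ (+ r ℤ.- + d) d⊥n (ℚₚ.toℚᵘ-fromℚᵘ (mkℚᵘ (+ r ℤ.- + d) d′))
  t<n = proj₁ t-spec
  t′<n = proj₁ t′-spec
  -- The numerators -r and r - d add up to -d, so the residues of the two fractions add up to -1
  -- modulo n.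
  t+t′ = complementary-residues (ℤ.- + r) (+ r ℤ.- + d) d⊥n t<n t′<n (proj₂ t-spec) (proj₂ t′-spec)
    (lemma (+ r) (+ d))
    where
    lemma : ∀ r d → ℤ.- r ℤ.+ (r ℤ.- d) ≡ ℤ.- d
    lemma = ℤ-Solver.solve-∀
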